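{- Let $n$, $c$, $s$ be fixed integers with $n,c\ge 2$ and $1\le s\le c-1$. Let $t=\lceil sn/c\rceil$ and let $\lambda\in[c]$ be the integer with $\lambda\equiv sn\pmod{c}$. Then \[\lim_{q\to\infty} f^q_{c,s}(n)\big/ q^t=\frac{\binom{n}{t}}{\binom{n}{t}-m(n,t,\lambda;s+1,c-s+1)}.\]
   Context: For a positive integer $m$, $[m]=\{1,\dots,m\}$. A code $\mathcal{C}\subseteq[q]^n$ is $(c,s)$-frameproof if for every $c+1$ codewords $\bm x^0,\bm x^1,\dots,\bm x^c\in\mathcal{C}$ with $\bm x^0\neq\bm x^j$ for each $j\in[c]$ (where $\bm x^1,\dots,\bm x^c$ need not be distinct), there is some coordinate $i\in[n]$ with $|\{j\in[c]: x^j_i=x^0_i\}|<s$. $f^q_{c,s}(n)$ denotes the maximum size of a $(c,s)$-frameproof code in $[q]^n$. A sequence $A_1,\dots,A_\lambda$ of subsets of $[n]$ (repetitions allowed) is $k_1$-disjoint if $\bigcap_{i\in B}A_i=\emptyset$ for every $k_1$-subset $B\subseteq[\lambda]$ (vacuous if $k_1>\lambda$); it is $k_2$-covering if $\bigcup_{i\in B}A_i=[n]$ for every $k_2$-subset $B\subseteq[\lambda]$ (vacuous if $k_2>\lambda$); it is $(k_1,k_2)$-disjoint if both hold. The generalized matching number $m(n,t,\lambda;k_1,k_2)$ is the maximum size of a family $\mathcal{F}$ of $t$-subsets of $[n]$ such that there are no $A_1,\dots,A_\lambda\in\mathcal{F}$ (not necessarily distinct) forming a $(k_1,k_2)$-disjoint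 sequence. -}

module Defs where

open import Data.Nat using (ℕ; zero; suc; _+_; _*_; _∸_; _≤_; _<_; _/_)
open import Data.Integer using (+_)
open import Data.Rational using (ℚ; 0ℚ) renaming (_/_ to _/ℚ_)
open import Data.Fin using (Fin; _≟_)
open import Data.Fin.Subset using (Subset; _∈_; ∣_∣)
open import Data.List using (List; length; filter; allFin)
open import Data.List.Membership.Propositional renaming (_∈_ to _∈ᴸ_)
open import Data.List.Relation.Unary.Unique.Propositional using (Unique)
open import Data.Product using (Σ; ∃; ∃-syntax; _×_)
open import Data.Sum using (_⊎_)
open import Relation.Binary.PropositionalEquality using (_≡_; _≢_)
open import Relation.Nullary using (¬_)

Word : ℕ → ℕ → Set
Word q n = Fin n → Fin q

-- A code is a finite set of words, represented as a duplicate-free list;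
-- its size is the length of the list.
Code : ℕ → ℕ → Set
Code q n = List (Word q n)

agreeCount : ∀ {q n c} → (Fin c → Word q n) → Word q n → Fin n → ℕ
agreeCount {c = c} xs x0 i = length (filter (λ j → xs j i ≟ x0 i) (allFin c))

IsFrameproof : (c s : ℕ) → ∀ {q n} → Code q n → Set
IsFrameproof c s {q} {n} C =
  (x0 : Word q n) → x0 ∈ᴸ C →
  (xs : Fin c → Word q n) → (∀ j → xs j ∈ᴸ C) → (∀ j → x0 ≢ xs j) →
  ∃[ i ] agreeCount xs x0 i < s

IsMaxSize : ∀ {A : Set} → (List A → Set) → ℕ → Set
IsMaxSize {A} P k =
  (Σ (List A) λ L → Unique L × P L × length L ≡ k) ×
  ((L : List A) → Unique L → P L → length L ≤ k)

IsFrameproofMax : (q c s n k : ℕ) → Set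
IsFrameproofMax q c s n k = IsMaxSize (IsFrameproof c s {q} {n}) k

KDisjoint : ∀ {n λ'} → ℕ → (Fin λ' → Subset n) → Set
KDisjoint {n} {λ'} k A =
  (B : Subset λ') → ∣ B ∣ ≡ k → ¬ (∃[ x ] (∀ i → i ∈ B → x ∈ A i))

KCovering : ∀ {n λ'} → ℕ → (Fin λ' → Subset n) → Set
KCovering {n} {λ'} k A =
  (B : Subset λ') → ∣ B ∣ ≡ k → (x : Fin n) → ∃[ i ] (i ∈ B × x ∈ A i)

IsGoodFamily : (n t λ' k₁ k₂ : ℕ) → List (Subset n) → Set
IsGoodFamily n t λ' k₁ k₂ F =
  (∀ {A} → A ∈ᴸ F → ∣ A ∣ ≡ t) ×
  ((A : Fin λ' → Subset n) → (∀ i → A i ∈ᴸ F) →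
     ¬ (KDisjoint k₁ A × KCovering k₂ A))

IsMatchingNumber : (n t λ' k₁ k₂ k : ℕ) → Set
IsMatchingNumber n t λ' k₁ k₂ k = IsMaxSize (IsGoodFamily n t λ' k₁ k₂) k

-- ⌈a / b⌉ (b = 0 gives 0; only used with b ≥ 2)
ceilDiv : ℕ → ℕ → ℕ
ceilDiv a zero = 0
ceilDiv a (suc b) = (a + b) / suc b

CongMod : ℕ → ℕ → ℕ → Set
CongMod a b c = ∃[ k ] (a + k * c ≡ b ⊎ b + k * c ≡ a)

-- a / d as a rational (d = 0 gives 0; only used with d > 0)
ratio : ℕ → ℕ → ℚ
ratio a zero = 0ℚ
ratio a (suc d) = (+ a) /ℚ suc d

{-# OPTIONS --safe #-}
-- Write s n = c (t − 1) + λ.  Cutting sets of size at most t that cover every coordinate at least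
-- s times down to multiplicity exactly s leaves at least λ sets of size t, any λ of which form an
-- (s + 1, c − s + 1)-disjoint sequence; conversely such a sequence is completed by c − λ sets of size
-- at most t − 1 to a cover with all multiplicities at least s.
--
-- Upper bound.  For a codeword x consider the t-sets of coordinates on which another codeword agrees
-- with x.  If they contain a disjoint sequence, then frameproofness and the completion make x the only
-- codeword with its restriction to some (t − 1)-set, which happens O(q^(t−1)) times.  Every other x is
-- the only codeword with its restriction to at least C(n,t) − m of the t-sets, and each t-set serves
-- at most q^t codewords.
--
-- Lower bound.  Let F be an optimal family.  Instead of a random packing we use an explicit code over
-- (ℤ/p)^C(n,t) with one word for each permutation σ and each message.  Plane T of a word is a
-- polynomial of degree at most t evaluated at the points 2^i, chosen such that its values on T determine
-- a tag: 0 if σ T ∈ F, and otherwise a number from which σ and one common parameter of the message can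
-- be read off.  By Vieta's formula, for two words that agree on a t-set T₀ the tags of plane T differ,
-- modulo p, by the difference of the leading coefficients times the difference of the sums of 2^i over
-- T and over T₀.  As subset sums of powers of 2 are distinct, agreement on T₀ with σ T₀ ∉ F, or on more than t coordinates,
-- forces equality of the words.  Letting p tend to infinity with q ≈ p^C(n,t) gives the limit.
module Submission where

-- Finite counting and sets with prescribed degrees.

module Counting where

  open import Data.Bool.Base using (Bool; true; false; not)
  open import Data.Fin.Base using (Fin; zero; suc)
  open import Data.Fin.Properties using (suc-injective; injective⇒≤)
  open import Data.Nat.Base
  open import Data.Nat.Properties hiding (suc-injective)
  open import Data.Product.Base using (Σ; _×_; _,_; proj₁; proj₂)
  open import Data.Sum.Base using ([_,_]′)
  open import Data.Vec.Functional using (_∷_)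
  open import Function.Base using (_∘_)
  open import Function.Definitions using (Injective)
  open import Relation.Binary.PropositionalEquality
  open import Relation.Nullary using (Dec; ¬_; yes; no; does; contradiction)
  open import Relation.Nullary.Decidable using (dec-true)
  open import Algebra.Properties.Semiring.Sum +-*-semiring
    using (sum; sum-cong-≗; ∑-comm; ∑-distrib-+; *-distribˡ-sum)

  witness : ∀ {a} {P : Set a} (P? : Dec P) → does P? ≡ true → P
  witness (yes p) _ = p

  refute : ∀ {a} {P : Set a} (P? : Dec P) → does P? ≡ false → ¬ P
  refute (no ¬p) _ = ¬p

  χ : Bool → ℕ
  χ true  = 1
  χ false = 0

  count : ∀ {n} → (Fin n → Bool) → ℕ
  count p = sum (χ ∘ p)

  χ≤1 : ∀ b → χ b ≤ 1
  χ≤1 true  = ≤-refl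
  χ≤1 false = z≤n

  χ-mono : ∀ {a b} → (a ≡ true → b ≡ true) → χ a ≤ χ b
  χ-mono {true}  a⇒b rewrite a⇒b refl = ≤-refl
  χ-mono {false} _   = z≤n

  χ-not : ∀ b → χ b + χ (not b) ≡ 1
  χ-not true  = refl
  χ-not false = refl

  sum-mono : ∀ {n} {f g : Fin n → ℕ} → (∀ i → f i ≤ g i) → sum f ≤ sum g
  sum-mono {zero}  f≤g = z≤n
  sum-mono {suc n} f≤g = +-mono-≤ (f≤g zero) (sum-mono (f≤g ∘ suc))

  sum-const : ∀ n k → sum {n} (λ _ → k) ≡ n * k
  sum-const zero    k = refl
  sum-const (suc n) k = cong (k +_) (sum-const n k)

  ≤sum : ∀ {n} (f : Fin n → ℕ) i → f i ≤ sum f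
  ≤sum f zero    = m≤m+n _ _
  ≤sum f (suc i) = ≤-trans (≤sum (f ∘ suc) i) (m≤n+m _ _)

  sum-mono-≡ : ∀ {n} {f g : Fin n → ℕ} → (∀ i → f i ≤ g i) → sum g ≤ sum f → ∀ i → f i ≡ g i
  sum-mono-≡ {f = f} {g} f≤g g≤f zero = ≤-antisym (f≤g zero)
    (+-cancelʳ-≤ (sum (g ∘ suc)) _ _ (≤-trans g≤f (+-monoʳ-≤ (f zero) (sum-mono (f≤g ∘ suc)))))
  sum-mono-≡ {f = f} {g} f≤g g≤f (suc i) = sum-mono-≡ (f≤g ∘ suc)
    (+-cancelˡ-≤ (g zero) _ _ (≤-trans g≤f (+-monoˡ-≤ _ (f≤g zero)))) i

  count-not : ∀ {n} (p : Fin n → Bool) → count p + count (not ∘ p) ≡ n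
  count-not {n} p = begin
    count p + count (not ∘ p)         ≡⟨ ∑-distrib-+ (χ ∘ p) (χ ∘ not ∘ p) ⟨
    sum (λ i → χ (p i) + χ (not (p i))) ≡⟨ sum-cong-≗ (χ-not ∘ p) ⟩
    sum {n} (λ _ → 1)                 ≡⟨ sum-const n 1 ⟩
    n * 1                             ≡⟨ *-identityʳ n ⟩
    n                                 ∎
    where open ≡-Reasoning

  count-mono-⊆ : ∀ {n} {p q : Fin n → Bool} → (∀ i → p i ≡ true → q i ≡ true) → count p ≤ count q
  count-mono-⊆ p⊆q = sum-mono (χ-mono ∘ p⊆q)

  χ-injective : ∀ {a b} → χ a ≡ χ b → a ≡ b
  χ-injective {true}  {true}  _ = refl
  χ-injective {false} {false} _ = refl

  ⊆-count-≡ : ∀ {n} {p q : Fin n → Bool} → (∀ i → p i ≡ true → q i ≡ true) →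
              count q ≤ count p → ∀ i → p i ≡ q i
  ⊆-count-≡ p⊆q q≤p i = χ-injective (sum-mono-≡ (χ-mono ∘ p⊆q) q≤p i)

  -- Greedy: an optional point is left out whenever the later points can still supply `k`.
  between : ∀ {n} (p q : Fin n → Bool) → (∀ i → p i ≡ true → q i ≡ true) →
            ∀ k → count p ≤ k → k ≤ count q →
            Σ (Fin n → Bool) λ b → (∀ i → p i ≡ true → b i ≡ true) ×
              (∀ i → b i ≡ true → q i ≡ true) × count b ≡ k
  between {zero}  p q p⊆q .0 p≤k z≤n = q , (λ ()) , (λ ()) , refl
  between {suc n} p q p⊆q k p≤k k≤q with p zero in p0 | q zero in q0
  between {suc n} p q p⊆q (suc k) (s≤s p≤k) k≤q | true | true =
    let b , p⊆b , b⊆q , |b|≡k = between (p ∘ suc) (q ∘ suc) (p⊆q ∘ suc) k p≤k (s≤s⁻¹ k≤q) in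
    true ∷ b , (λ { zero _ → refl ; (suc i) → p⊆b i }) ,
    (λ { zero _ → q0 ; (suc i) → b⊆q i }) , cong suc |b|≡k
  ... | true | false = contradiction (trans (sym q0) (p⊆q zero p0)) λ ()
  ... | false | false =
    let b , p⊆b , b⊆q , |b|≡k = between (p ∘ suc) (q ∘ suc) (p⊆q ∘ suc) k p≤k k≤q in
    false ∷ b , (λ { zero e → trans (sym p0) e ; (suc i) → p⊆b i }) ,
    (λ { zero () ; (suc i) → b⊆q i }) , |b|≡k
  ... | false | true with k ≤? count (q ∘ suc)
  ...   | yes k≤q' =
    let b , p⊆b , b⊆q , |b|≡k = between (p ∘ suc) (q ∘ suc) (p⊆q ∘ suc) k p≤k k≤q' in
    false ∷ b , (λ { zero e → trans (sym p0) e ; (suc i) → p⊆b i }) ,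
    (λ { zero () ; (suc i) → b⊆q i }) , |b|≡k
  -- Here `k` exceeds the supply of the tail but not `count q`, so it equals `count q` and all of
  -- `q` is taken.
  ...   | no  k≰q' = true ∷ (q ∘ suc) ,
    (λ { zero _ → refl ; (suc i) → p⊆q (suc i) }) ,
    (λ { zero _ → q0 ; (suc i) e → e }) , ≤-antisym (≰⇒> k≰q') k≤q

  subset-of-size : ∀ {n} (q : Fin n → Bool) k → k ≤ count q →
                   Σ (Fin n → Bool) λ b → (∀ i → b i ≡ true → q i ≡ true) × count b ≡ k
  subset-of-size {n} q k k≤q =
    let b , _ , b⊆q , e = between (λ _ → false) q (λ _ ()) k
                            (≤-trans (≤-reflexive (trans (sum-const n 0) (*-zeroʳ n))) z≤n) k≤q
    in b , b⊆q , e

  degree : ∀ {b n} → (Fin b → Fin n → Bool) → Fin n → ℕ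
  degree A x = count (λ j → A j x)

  -- Greedy: each round picks one set and lowers the demand `r`. Two invariants persist: no demand
  -- exceeds the number of sets still to come, and the total demand is at most their total capacity.
  arrange : ∀ {n} b k (r : Fin n → ℕ) → (∀ x → r x ≤ b) → sum r ≤ b * k →
            Σ (Fin b → Fin n → Bool) λ A → (∀ j → count (A j) ≤ k) × (∀ x → r x ≤ degree A x)
  arrange zero    k r r≤b Σr≤bk = (λ ()) , (λ ()) , r≤b
  arrange {n} (suc b) k r r≤b Σr≤bk =
    B ∷ A , (λ { zero → ≤-trans (≤-reflexive |B|≡k') (m⊓n≤m k _) ; (suc j) → |A|≤k j }) ,
    (λ x → ≤-trans (≤-reflexive (sym (r'+B x))) (≤-trans (≤-reflexive (+-comm (r' x) _)) (+-monoʳ-≤ (χ (B x)) (r'≤A x))))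
    where
    -- `p` marks the critical points, which every remaining set has to contain; `q` marks the points
    -- with some demand left. At most `k` points are critical, since each uses up `suc b` of a total
    -- of at most `suc b * k`.
    p q : Fin n → Bool
    p x = does (r x ≟ suc b)
    q x = does (1 ≤? r x)
    p⇒ : ∀ x → p x ≡ true → r x ≡ suc b
    p⇒ x = witness (r x ≟ suc b)
    q⇒ : ∀ x → q x ≡ true → 1 ≤ r x
    q⇒ x = witness (1 ≤? r x)
    p⊆q : ∀ x → p x ≡ true → q x ≡ true
    p⊆q x e = dec-true (1 ≤? r x) (subst (1 ≤_) (sym (p⇒ x e)) (s≤s z≤n))
    |p|≤k : count p ≤ k
    |p|≤k = *-cancelˡ-≤ (suc b) (begin
      suc b * count p              ≡⟨ *-distribˡ-sum (suc b) (χ ∘ p) ⟩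
      sum (λ x → suc b * χ (p x))  ≤⟨ sum-mono pr ⟩
      sum r                        ≤⟨ Σr≤bk ⟩
      suc b * k                    ∎)
      where
      open ≤-Reasoning
      pr : ∀ x → suc b * χ (p x) ≤ r x
      pr x with p x in e
      ... | true  = ≤-reflexive (trans (*-identityʳ (suc b)) (sym (p⇒ x e)))
      ... | false = ≤-trans (≤-reflexive (*-zeroʳ b)) z≤n
    choice = between p q p⊆q (k ⊓ count q) (⊓-glb |p|≤k (count-mono-⊆ p⊆q)) (m⊓n≤n k _)
    B = proj₁ choice
    p⊆B = proj₁ (proj₂ choice)
    B⊆q = proj₁ (proj₂ (proj₂ choice))
    |B|≡k' = proj₂ (proj₂ (proj₂ choice))
    r' : Fin n → ℕ
    r' x = r x ∸ χ (B x)
    r'+B : ∀ x → r' x + χ (B x) ≡ r x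
    r'+B x = m∸n+n≡m (≤-trans (χ-mono {B x} {q x} (B⊆q x)) (h x))
      where
      h : ∀ x → χ (q x) ≤ r x
      h x with q x in e
      ... | true  = q⇒ x e
      ... | false = z≤n
    r'≤b : ∀ x → r' x ≤ b
    r'≤b x with r x ≟ suc b
    ... | yes e rewrite e | p⊆B x (dec-true (r x ≟ suc b) e) = ≤-refl
    ... | no  e = ≤-trans (m∸n≤m (r x) (χ (B x))) (s≤s⁻¹ (≤∧≢⇒< (r≤b x) e))
    Σr' : sum r' + count B ≡ sum r
    Σr' = trans (sym (∑-distrib-+ r' (χ ∘ B))) (sum-cong-≗ r'+B)
    r'≤bq : ∀ x → r' x ≤ b * χ (q x)
    r'≤bq x with q x in e
    ... | true  = ≤-trans (r'≤b x) (≤-reflexive (sym (*-identityʳ b)))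
    ... | false = ≤-trans (m∸n≤m (r x) (χ (B x))) (≤-trans (s≤s⁻¹ (≰⇒> (refute (1 ≤? r x) e))) z≤n)
    Σr'≤bk : sum r' ≤ b * k
    -- If `q` has at least `k` points, the round uses its full capacity `k`. Otherwise at most `k`
    -- points had any demand, and each keeps at most `b`.
    Σr'≤bk = [ k-bounded , q-bounded ]′ (≤-total k (count q))
      where
      open ≤-Reasoning
      k-bounded : k ≤ count q → sum r' ≤ b * k
      k-bounded k≤q = +-cancelʳ-≤ k _ _ (begin
        sum r' + k        ≡⟨ cong (sum r' +_) (trans |B|≡k' (m≤n⇒m⊓n≡m k≤q)) ⟨
        sum r' + count B  ≡⟨ Σr' ⟩
        sum r             ≤⟨ Σr≤bk ⟩
        k + b * k         ≡⟨ +-comm k _ ⟩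
        b * k + k         ∎)
      q-bounded : count q ≤ k → sum r' ≤ b * k
      q-bounded q≤k = begin
        sum r'                   ≤⟨ sum-mono r'≤bq ⟩
        sum (λ x → b * χ (q x))  ≡⟨ *-distribˡ-sum b (χ ∘ q) ⟨
        b * count q              ≤⟨ *-monoʳ-≤ b q≤k ⟩
        b * k                    ∎
    rest = arrange b k r' r'≤b Σr'≤bk
    A = proj₁ rest
    |A|≤k = proj₁ (proj₂ rest)
    r'≤A = proj₂ (proj₂ rest)

  -- The last component records injectivity in the form used for degrees: they cannot grow when only
  -- some of the sets are kept.
  select : ∀ {c} (p : Fin c → Bool) l → l ≤ count p →
           Σ (Fin l → Fin c) λ e → (∀ i → p (e i) ≡ true) × Injective _≡_ _≡_ e ×
             (∀ h → sum (h ∘ e) ≤ sum h)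
  select p zero l≤p = (λ ()) , (λ ()) , (λ { {()} }) , λ _ → z≤n
  select {suc c} p (suc l) l≤p with p zero in p0
  ... | true =
    let e , pe , e-inj , le = select (p ∘ suc) l (s≤s⁻¹ l≤p) in
    zero ∷ (suc ∘ e) , (λ { zero → p0 ; (suc i) → pe i }) ,
    (λ { {zero} {zero} _ → refl ; {suc i} {suc j} eq → cong suc (e-inj (suc-injective eq)) }) ,
    λ h → +-monoʳ-≤ (h zero) (le (h ∘ suc))
  ... | false =
    let e , pe , e-inj , le = select (p ∘ suc) (suc l) l≤p in
    suc ∘ e , pe , e-inj ∘ suc-injective , λ h → ≤-trans (le (h ∘ suc)) (m≤n+m _ _)

  count-injective : ∀ {m k} (p : Fin m → Bool) (g : Fin m → Fin k) →
                    (∀ i j → p i ≡ true → p j ≡ true → g i ≡ g j → i ≡ j) → count p ≤ k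
  count-injective p g g-inj =
    let e , pe , e-inj , _ = select p (count p) ≤-refl in
    injective⇒≤ {f = g ∘ e} λ eq → e-inj (g-inj _ _ (pe _) (pe _) eq)

  -- The degree form of (s + 1, u + 1)-disjointness.
  Balanced : ∀ {l n} → ℕ → ℕ → (Fin l → Fin n → Bool) → Set
  Balanced s u A = ∀ x → degree A x ≤ s × count (λ j → not (A j x)) ≤ u

  -- Cutting the sets down until every point is covered exactly s times leaves total size
  -- s n = c t + l, so at least l of the sets must have kept all their t + 1 points.
  balanced-subsequence : ∀ {c n} s t l u → s + u ≡ c → s * n ≡ c * t + l →
    (A : Fin c → Fin n → Bool) → (∀ j → count (A j) ≤ suc t) → (∀ x → s ≤ degree A x) →
    Σ (Fin l → Fin c) λ e → (∀ i → count (A (e i)) ≡ suc t) × Balanced s u (A ∘ e)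
  balanced-subsequence {c} {n} s t l u s+u≡c sn≡ct+l A |A|≤ s≤A =
    e , (λ i → ≤-antisym (|A|≤ (e i)) (≤-trans (full⇒ (e i) (pe i)) (count-mono-⊆ (A'⊆A (e i))))) , bal
    where
    trimmed : ∀ x → _
    trimmed x = subset-of-size (λ j → A j x) s (s≤A x)
    A' : Fin c → Fin n → Bool
    A' j x = proj₁ (trimmed x) j
    A'⊆A : ∀ j x → A' j x ≡ true → A j x ≡ true
    A'⊆A j x = proj₁ (proj₂ (trimmed x)) j
    full : Fin c → Bool
    full j = does (suc t ≤? count (A' j))
    full⇒ : ∀ j → full j ≡ true → suc t ≤ count (A' j)
    full⇒ j = witness (suc t ≤? count (A' j))
    |A'|≤ : ∀ j → count (A' j) ≤ t + χ (full j)
    |A'|≤ j with full j in e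
    ... | true  = ≤-trans (count-mono-⊆ (A'⊆A j)) (≤-trans (|A|≤ j) (≤-reflexive (+-comm 1 t)))
    ... | false = ≤-trans (s≤s⁻¹ (≰⇒> (refute (suc t ≤? count (A' j)) e))) (m≤m+n t 0)
    l≤full : l ≤ count full
    l≤full = +-cancelˡ-≤ (c * t) _ _ (begin
      c * t + l                             ≡⟨ sn≡ct+l ⟨
      s * n                                 ≡⟨ *-comm s n ⟩
      n * s                                 ≡⟨ sum-const n s ⟨
      sum {n} (λ _ → s)                     ≡⟨ sum-cong-≗ (λ x → sym (proj₂ (proj₂ (trimmed x)))) ⟩
      sum (λ x → sum (λ j → χ (A' j x)))    ≡⟨ ∑-comm (λ x j → χ (A' j x)) ⟩
      sum (λ j → count (A' j))              ≤⟨ sum-mono |A'|≤ ⟩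
      sum (λ j → t + χ (full j))            ≡⟨ ∑-distrib-+ (λ _ → t) (χ ∘ full) ⟩
      sum {c} (λ _ → t) + count full        ≡⟨ cong (_+ count full) (sum-const c t) ⟩
      c * t + count full                    ∎)
      where open ≤-Reasoning
    chosen = select full l l≤full
    e = proj₁ chosen
    pe = proj₁ (proj₂ chosen)
    e-sum = proj₂ (proj₂ (proj₂ chosen))
    -- A chosen set still has `suc t` points after trimming and had no more before, so it lost
    -- nothing, and the exact multiplicity `s` of the trimmed family bounds both counts.
    A≡A' : ∀ i x → A (e i) x ≡ A' (e i) x
    A≡A' i x = sym (⊆-count-≡ (A'⊆A (e i)) (≤-trans (|A|≤ (e i)) (full⇒ (e i) (pe i))) x)
    bal : Balanced s u (A ∘ e)
    bal x = (begin
        degree (A ∘ e) x             ≡⟨ sum-cong-≗ (λ i → cong χ (A≡A' i x)) ⟩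
        degree (A' ∘ e) x            ≤⟨ e-sum (λ j → χ (A' j x)) ⟩
        degree A' x                  ≡⟨ proj₂ (proj₂ (trimmed x)) ⟩
        s                            ∎) ,
      +-cancelˡ-≤ s _ _ (begin
        s + count (λ i → not (A (e i) x))            ≡⟨ cong (s +_) (sum-cong-≗ (λ i → cong (χ ∘ not) (A≡A' i x))) ⟩
        s + count (λ i → not (A' (e i) x))           ≤⟨ +-monoʳ-≤ s (e-sum (λ j → χ (not (A' j x)))) ⟩
        s + count (λ j → not (A' j x))               ≡⟨ cong (_+ count (λ j → not (A' j x))) (proj₂ (proj₂ (trimmed x))) ⟨
        degree A' x + count (λ j → not (A' j x))     ≡⟨ count-not (λ j → A' j x) ⟩
        c                                            ≡⟨ s+u≡c ⟨
        s + u                                        ∎)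
      where open ≤-Reasoning

-- Subsets of fixed size and disjoint, covering sequences.

module Subsets where

  open Counting
  open import Defs
  open import Data.Bool.Base using (Bool; true; false; not)
  import Data.Bool.Properties as Bool
  open import Data.Fin.Base using (Fin; zero; suc; splitAt; combine; remQuot; punchIn)
  open import Data.Fin.Properties as Fin using (any?; all?; combine-injective; injective⇒≤)
  open import Data.Fin.Subset using (Subset; _∈_; ∣_∣; inside; outside)
  open import Data.Fin.Subset.Properties using (_∈?_; ∣p∣≤n)
  open import Data.List.Base as List using (List; []; _∷_; _++_; length; filter)
  open import Data.List.Properties using (length-map; length-++; tabulate-lookup)
  open import Data.List.Membership.Propositional using () renaming (_∈_ to _∈ᴸ_)
  open import Data.List.Membership.Propositional.Properties
    using (∈-lookup; ∈-map⁺; ∈-map⁻; ∈-++⁺ˡ; ∈-++⁺ʳ; ∈-++⁻; ∈-filter⁻)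
  open import Data.List.Relation.Unary.All as All using ()
  open import Data.List.Relation.Unary.AllPairs using ([]; _∷_)
  open import Data.List.Relation.Unary.Any using (here; index)
  open import Data.List.Relation.Unary.Any.Properties using (lookup-index)
  open import Data.List.Relation.Unary.Unique.Propositional using (Unique)
  import Data.List.Relation.Unary.Unique.Propositional.Properties as Unique
  open import Data.Nat.Base
  open import Data.Nat.Combinatorics using (_C_; nCk+nC[k+1]≡[n+1]C[k+1])
  open import Data.Nat.Properties
  open import Data.Product.Base as Product using (Σ; ∃-syntax; _×_; _,_; proj₁; proj₂)
  open import Data.Sum.Base using (_⊎_; inj₁; inj₂; [_,_]′; map₁)
  open import Data.Vec.Base using ([]; _∷_; lookup; tabulate; there; removeAt)
  open import Data.Vec.Properties using (lookup∘tabulate; []=⇒lookup; lookup⇒[]=; ∷-injectiveʳ; ≡-dec)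
  open import Function.Base using (_∘_; id)
  open import Relation.Binary.PropositionalEquality
  open import Relation.Nullary using (Dec; ¬_; yes; no; does; contradiction; _×-dec_; _→-dec_; ¬?)
  open import Relation.Nullary.Decidable using (dec-true; dec-false)
  open import Relation.Unary using (Pred; Decidable)
  open import Algebra.Properties.Semiring.Sum +-*-semiring
    using (sum; sum-cong-≗; ∑-comm; ∑-distrib-+; *-distribˡ-sum; *-distribʳ-sum)

  ∣-∣≡count : ∀ {n} (p : Subset n) → ∣ p ∣ ≡ count (lookup p)
  ∣-∣≡count []          = refl
  ∣-∣≡count (true  ∷ p) = cong suc (∣-∣≡count p)
  ∣-∣≡count (false ∷ p) = ∣-∣≡count p

  ∣tabulate∣ : ∀ {n} (p : Fin n → Bool) → ∣ tabulate p ∣ ≡ count p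
  ∣tabulate∣ p = trans (∣-∣≡count (tabulate p)) (sum-cong-≗ (cong χ ∘ lookup∘tabulate p))

  ∈ˢ-tabulate⁻ : ∀ {n} (p : Fin n → Bool) {i} → i ∈ tabulate p → p i ≡ true
  ∈ˢ-tabulate⁻ p {i} i∈p = trans (sym (lookup∘tabulate p i)) ([]=⇒lookup i∈p)

  lookup-injective : ∀ {a} {A : Set a} {xs : List A} → Unique xs → ∀ {i j} →
                     List.lookup xs i ≡ List.lookup xs j → i ≡ j
  lookup-injective (_  ∷ _)   {zero}  {zero}  _  = refl
  lookup-injective {xs = _ ∷ xs} (x# ∷ _)   {zero}  {suc j} eq = contradiction eq (All.lookup x# (∈-lookup j))
  lookup-injective {xs = _ ∷ xs} (x# ∷ _)   {suc i} {zero}  eq = contradiction (sym eq) (All.lookup x# (∈-lookup i))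
  lookup-injective (_  ∷ xs!) {suc i} {suc j} eq = cong suc (lookup-injective xs! eq)

  Unique-⊆⇒length≤ : ∀ {a} {A : Set a} {xs ys : List A} → Unique xs →
                     (∀ {x} → x ∈ᴸ xs → x ∈ᴸ ys) → length xs ≤ length ys
  Unique-⊆⇒length≤ {xs = xs} {ys} xs! xs⊆ys = injective⇒≤ {f = λ i → index (xs⊆ys (∈-lookup i))} λ {i} {j} eq →
    lookup-injective xs! (begin
      List.lookup xs i                                  ≡⟨ lookup-index (xs⊆ys (∈-lookup i)) ⟩
      List.lookup ys (index (xs⊆ys (∈-lookup i)))       ≡⟨ cong (List.lookup ys) eq ⟩
      List.lookup ys (index (xs⊆ys (∈-lookup j)))       ≡⟨ lookup-index (xs⊆ys (∈-lookup j)) ⟨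
      List.lookup xs j                                  ∎)
    where open ≡-Reasoning

  subsetsOfSize : ∀ n → ℕ → List (Subset n)
  subsetsOfSize zero    zero    = [] ∷ []
  subsetsOfSize zero    (suc t) = []
  subsetsOfSize (suc n) zero    = List.map (outside ∷_) (subsetsOfSize n zero)
  subsetsOfSize (suc n) (suc t) =
    List.map (inside ∷_) (subsetsOfSize n t) ++ List.map (outside ∷_) (subsetsOfSize n (suc t))

  ∈-subsetsOfSize⁺ : ∀ {n} (p : Subset n) → p ∈ᴸ subsetsOfSize n ∣ p ∣
  ∈-subsetsOfSize⁺ []          = here refl
  ∈-subsetsOfSize⁺ (true  ∷ p) = ∈-++⁺ˡ (∈-map⁺ (inside ∷_) (∈-subsetsOfSize⁺ p))
  ∈-subsetsOfSize⁺ {suc n} (false ∷ p) with ∣ p ∣ | ∈-subsetsOfSize⁺ p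
  ... | zero  | p∈ = ∈-map⁺ (outside ∷_) p∈
  ... | suc t | p∈ = ∈-++⁺ʳ (List.map (inside ∷_) (subsetsOfSize n t)) (∈-map⁺ (outside ∷_) p∈)

  ∈-subsetsOfSize⁻ : ∀ n t {p : Subset n} → p ∈ᴸ subsetsOfSize n t → ∣ p ∣ ≡ t
  ∈-subsetsOfSize⁻ zero    zero    (here refl) = refl
  ∈-subsetsOfSize⁻ (suc n) zero    p∈ with _ , q∈ , refl ← ∈-map⁻ (outside ∷_) p∈ = ∈-subsetsOfSize⁻ n zero q∈
  ∈-subsetsOfSize⁻ (suc n) (suc t) p∈ with ∈-++⁻ (List.map (inside ∷_) (subsetsOfSize n t)) p∈
  ... | inj₁ p∈ˡ with _ , q∈ , refl ← ∈-map⁻ (inside ∷_)  p∈ˡ = cong suc (∈-subsetsOfSize⁻ n t q∈)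
  ... | inj₂ p∈ʳ with _ , q∈ , refl ← ∈-map⁻ (outside ∷_) p∈ʳ = ∈-subsetsOfSize⁻ n (suc t) q∈

  subsetsOfSize-! : ∀ n t → Unique (subsetsOfSize n t)
  subsetsOfSize-! zero    zero    = All.[] ∷ []
  subsetsOfSize-! zero    (suc t) = []
  subsetsOfSize-! (suc n) zero    = Unique.map⁺ ∷-injectiveʳ (subsetsOfSize-! n zero)
  subsetsOfSize-! (suc n) (suc t) = Unique.++⁺
    (Unique.map⁺ ∷-injectiveʳ (subsetsOfSize-! n t))
    (Unique.map⁺ ∷-injectiveʳ (subsetsOfSize-! n (suc t)))
    λ (∈ˡ , ∈ʳ) → case (∈-map⁻ (inside ∷_) ∈ˡ) (∈-map⁻ (outside ∷_) ∈ʳ)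
    where
    case : ∀ {p} → (∃[ q ] q ∈ᴸ subsetsOfSize n t × p ≡ inside ∷ q) →
           ¬ (∃[ q ] q ∈ᴸ subsetsOfSize n (suc t) × p ≡ outside ∷ q)
    case (_ , _ , refl) (_ , _ , ())

  length-subsetsOfSize : ∀ n t → length (subsetsOfSize n t) ≡ n C t
  length-subsetsOfSize zero    zero    = refl
  length-subsetsOfSize zero    (suc t) = refl
  length-subsetsOfSize (suc n) zero    =
    trans (length-map (outside ∷_) (subsetsOfSize n zero)) (length-subsetsOfSize n zero)
  length-subsetsOfSize (suc n) (suc t) = begin
    length (List.map (inside ∷_) (subsetsOfSize n t) ++ List.map (outside ∷_) (subsetsOfSize n (suc t)))
      ≡⟨ length-++ (List.map (inside ∷_) (subsetsOfSize n t)) ⟩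
    length (List.map (inside ∷_) (subsetsOfSize n t)) + length (List.map (outside ∷_) (subsetsOfSize n (suc t)))
      ≡⟨ cong₂ _+_ (length-map _ (subsetsOfSize n t)) (length-map _ (subsetsOfSize n (suc t))) ⟩
    length (subsetsOfSize n t) + length (subsetsOfSize n (suc t))
      ≡⟨ cong₂ _+_ (length-subsetsOfSize n t) (length-subsetsOfSize n (suc t)) ⟩
    n C t + n C suc t
      ≡⟨ nCk+nC[k+1]≡[n+1]C[k+1] n t ⟩
    suc n C suc t ∎
    where open ≡-Reasoning

  module _ {l n} (A : Fin l → Subset n) where

    Balanced⇒KDisjoint : ∀ {s u} → Balanced s u (lookup ∘ A) → KDisjoint (s + 1) A
    Balanced⇒KDisjoint {s} bal B |B|≡s+1 (x , x∈A) = <-irrefl refl (begin-strict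
      s                            <⟨ n<1+n s ⟩
      suc s                        ≡⟨ +-comm 1 s ⟩
      s + 1                        ≡⟨ |B|≡s+1 ⟨
      ∣ B ∣                        ≡⟨ ∣-∣≡count B ⟩
      count (lookup B)             ≤⟨ count-mono-⊆ (λ i e → []=⇒lookup (x∈A i (lookup⇒[]= i B e))) ⟩
      degree (lookup ∘ A) x        ≤⟨ proj₁ (bal x) ⟩
      s                            ∎)
      where open ≤-Reasoning

    Balanced⇒KCovering : ∀ {s u} → Balanced s u (lookup ∘ A) → KCovering (u + 1) A
    Balanced⇒KCovering {s} {u} bal B |B|≡u+1 x with any? (λ i → (i ∈? B) ×-dec (x ∈? A i))
    ... | yes found = found
    ... | no  none  = contradiction (begin-strict
      u                                     <⟨ n<1+n u ⟩
      suc u                                 ≡⟨ +-comm 1 u ⟩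
      u + 1                                 ≡⟨ |B|≡u+1 ⟨
      ∣ B ∣                                 ≡⟨ ∣-∣≡count B ⟩
      count (lookup B)                      ≤⟨ count-mono-⊆ missed ⟩
      count (λ i → not (lookup (A i) x))    ≤⟨ proj₂ (bal x) ⟩
      u                                     ∎) (<-irrefl refl)
      where
      open ≤-Reasoning
      missed : ∀ i → lookup B i ≡ true → not (lookup (A i) x) ≡ true
      missed i i∈B with lookup (A i) x in e
      ... | true  = contradiction (i , lookup⇒[]= i B i∈B , lookup⇒[]= x (A i) e) none
      ... | false = refl

    -- A failing bound at `x` gives more than `s` sets containing `x` or more than `u` sets missing
    -- it; selecting exactly `s + 1` or `u + 1` of them contradicts the hypothesis.
    KDisjoint∧KCovering⇒Balanced : ∀ {s u} → KDisjoint (s + 1) A → KCovering (u + 1) A →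
                                   Balanced s u (lookup ∘ A)
    KDisjoint∧KCovering⇒Balanced {s} {u} disj cov x = ≮⇒≥ many , ≮⇒≥ few
      where
      many : ¬ (s < degree (lookup ∘ A) x)
      many s<deg =
        let b , b⊆ , |b| = subset-of-size (λ i → lookup (A i) x) (s + 1) (subst (_≤ degree (lookup ∘ A) x) (+-comm 1 s) s<deg)
        in disj (tabulate b) (trans (∣tabulate∣ b) |b|)
             (x , λ i i∈b → lookup⇒[]= x (A i) (b⊆ i (∈ˢ-tabulate⁻ b i∈b)))
      few : ¬ (u < count (λ i → not (lookup (A i) x)))
      few u<miss =
        let b , b⊆ , |b| = subset-of-size (λ i → not (lookup (A i) x)) (u + 1) (subst (_≤ count (λ i → not (lookup (A i) x))) (+-comm 1 u) u<miss)
            i , i∈b , x∈A = cov (tabulate b) (trans (∣tabulate∣ b) |b|) x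
        in contradiction (trans (sym (b⊆ i (∈ˢ-tabulate⁻ b i∈b))) (cong not ([]=⇒lookup x∈A))) λ ()

  Balanced-cong : ∀ {l n s u} {A A' : Fin l → Fin n → Bool} → (∀ j x → A j x ≡ A' j x) →
                  Balanced s u A → Balanced s u A'
  Balanced-cong A≡A' bal x =
    ≤-trans (≤-reflexive (sum-cong-≗ λ j → cong χ (sym (A≡A' j x)))) (proj₁ (bal x)) ,
    ≤-trans (≤-reflexive (sum-cong-≗ λ j → cong (χ ∘ not) (sym (A≡A' j x)))) (proj₂ (bal x))

  -- Constant demand `s` fits into `c` sets of at most `suc t` points because
  -- `s n = c t + l ≤ c (t + 1)`. Consequently a good family cannot contain all sets of its size,
  -- which makes the denominator of the limit positive.
  balanced-exists : ∀ {c} n s t l u → s + u ≡ c → l ≤ c → s * n ≡ c * t + l →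
                    Σ (Fin l → Subset n) λ A → (∀ i → ∣ A i ∣ ≡ suc t) × Balanced s u (lookup ∘ A)
  balanced-exists {c} n s t l u s+u≡c l≤c sn≡ct+l =
    tabulate ∘ A ∘ e , (λ i → trans (∣tabulate∣ (A (e i))) (|Ae| i)) ,
    Balanced-cong (λ j x → sym (lookup∘tabulate (A (e j)) x)) bal
    where
    arr = arrange {n} c (suc t) (λ _ → s) (λ _ → ≤-trans (m≤m+n s u) (≤-reflexive s+u≡c)) (begin
      sum {n} (λ _ → s) ≡⟨ sum-const n s ⟩
      n * s             ≡⟨ *-comm n s ⟩
      s * n             ≡⟨ sn≡ct+l ⟩
      c * t + l         ≤⟨ +-monoʳ-≤ (c * t) l≤c ⟩
      c * t + c         ≡⟨ +-comm (c * t) c ⟩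
      c + c * t         ≡⟨ *-suc c t ⟨
      c * suc t         ∎)
      where open ≤-Reasoning
    A = proj₁ arr
    sub = balanced-subsequence s t l u s+u≡c sn≡ct+l A (proj₁ (proj₂ arr)) (proj₂ (proj₂ arr))
    e = proj₁ sub
    |Ae| = proj₁ (proj₂ sub)
    bal = proj₂ (proj₂ sub)

  length-filter-tabulate : ∀ {a p} {A : Set a} {P : Pred A p} (P? : Decidable P) {n} (f : Fin n → A) →
                           length (filter P? (List.tabulate f)) ≡ count (does ∘ P? ∘ f)
  length-filter-tabulate P? {zero}  f = refl
  length-filter-tabulate P? {suc n} f with does (P? (f zero))
  ... | true  = cong suc (length-filter-tabulate P? (f ∘ suc))
  ... | false = length-filter-tabulate P? (f ∘ suc)

  length-filter : ∀ {a p} {A : Set a} {P : Pred A p} (P? : Decidable P) (xs : List A) →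
                  length (filter P? xs) ≡ count (does ∘ P? ∘ List.lookup xs)
  length-filter P? xs =
    trans (cong (length ∘ filter P?) (sym (tabulate-lookup xs))) (length-filter-tabulate P? (List.lookup xs))

  sum-splitAt : ∀ m {n} (h : Fin m ⊎ Fin n → ℕ) →
                sum (h ∘ splitAt m) ≡ sum (h ∘ inj₁) + sum (h ∘ inj₂)
  sum-splitAt zero    h = refl
  sum-splitAt (suc m) h =
    trans (cong (h (inj₁ zero) +_) (sum-splitAt m (h ∘ map₁ suc))) (sym (+-assoc (h (inj₁ zero)) _ _))

  -- Own sets of codewords and the upper bound.

  AgreeOn : ∀ {q n} → Subset n → Word q n → Word q n → Set
  AgreeOn T x y = ∀ i → i ∈ T → x i ≡ y i

  restrict : ∀ {q n} (T : Subset n) → Word q n → Fin (q ^ ∣ T ∣)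
  restrict []          x = zero
  restrict (true  ∷ T) x = combine (x zero) (restrict T (x ∘ suc))
  restrict (false ∷ T) x = restrict T (x ∘ suc)

  restrict-injective : ∀ {q n} (T : Subset n) (x y : Word q n) → restrict T x ≡ restrict T y → AgreeOn T x y
  restrict-injective (true  ∷ T) x y eq zero    _         = proj₁ (combine-injective (x zero) _ (y zero) _ eq)
  restrict-injective (true  ∷ T) x y eq (suc i) (there p) =
    restrict-injective T (x ∘ suc) (y ∘ suc) (proj₂ (combine-injective (x zero) _ (y zero) _ eq)) i p
  restrict-injective (false ∷ T) x y eq (suc i) (there p) = restrict-injective T (x ∘ suc) (y ∘ suc) eq i p

  -- Here `c` is split into the `l` sets of a balanced sequence and the `b` sets that complete it,
  -- and `t` is one less than in the theorem.
  module UpperBound {q n} (l b s u t : ℕ) (s+u≡c : s + u ≡ l + b) (sn≡ct+l : s * n ≡ (l + b) * t + l)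
    (t≤n : t ≤ n) (C : Code q n) (C! : Unique C) (frameproof : IsFrameproof (l + b) s C) where

    N : ℕ
    N = length C

    X : Fin N → Word q n
    X = List.lookup C

    Shared : Fin N → Subset n → Set
    Shared i T = ∃[ j ] j ≢ i × AgreeOn T (X j) (X i)

    shared? : ∀ i → Decidable (Shared i)
    shared? i T = any? λ j → ¬? (j Fin.≟ i) ×-dec all? λ x → (x ∈? T) →-dec (X j x Fin.≟ X i x)

    -- Own subsets in the sense used for cover-free families, as a Boolean so that they can be
    -- counted.
    own : Fin N → Subset n → Bool
    own i T = not (does (shared? i T))

    own⇒ : ∀ i T → own i T ≡ true → ¬ Shared i T
    own⇒ i T e with shared? i T
    ... | no h = h

    -- Codewords that own `T` have pairwise distinct restrictions to `T`.
    count-own : ∀ T → count (λ i → own i T) ≤ q ^ ∣ T ∣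
    count-own T = count-injective _ (λ i → restrict T (X i)) inj
      where
      inj : ∀ i j → own i T ≡ true → own j T ≡ true → restrict T (X i) ≡ restrict T (X j) → i ≡ j
      inj i j own-i _ eq with i Fin.≟ j
      ... | yes i≡j = i≡j
      ... | no  i≢j = contradiction (j , i≢j ∘ sym , restrict-injective T (X j) (X i) (sym eq)) (own⇒ i T own-i)

    module _ (i : Fin N) (all-shared : ∀ T → ∣ T ∣ ≡ t → Shared i T) where

      small-shared : (p : Fin n → Bool) → count p ≤ t →
                     ∃[ j ] j ≢ i × (∀ x → p x ≡ true → X j x ≡ X i x)
      small-shared p p≤t =
        let T , p⊆T , _ , |T| = between p (λ _ → true) (λ _ _ → refl) t p≤t
                                  (≤-trans t≤n (≤-reflexive (sym (trans (sum-const n 1) (*-identityʳ n)))))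
            j , j≢i , agree = all-shared (tabulate T) (trans (∣tabulate∣ T) |T|)
        in j , j≢i , λ x px → agree x (lookup⇒[]= x (tabulate T) (trans (lookup∘tabulate T x) (p⊆T x px)))

      -- Each `A j` is shared with a codeword `y j`. The remaining demand `r` is met by `b` sets of
      -- at most `t` points, each shared with a codeword `z j`. These `l + b` codewords together
      -- agree with `X i` at least `s` times at every coordinate, against frameproofness.
      no-balanced : (A : Fin l → Subset n) → (∀ j → ∣ A j ∣ ≡ suc t) → (∀ j → Shared i (A j)) →
                    ¬ Balanced s u (lookup ∘ A)
      no-balanced A |A| sharedA bal = <-irrefl refl (begin-strict
        s                                           ≡⟨ m+[n∸m]≡n (proj₁ (bal x)) ⟨
        degree (lookup ∘ A) x + r x                 ≤⟨ +-mono-≤ (count-mono-⊆ (λ j e → dec-true (X (y j) x Fin.≟ X i x) (y-agree j x e)))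
                                                         (≤-trans (r≤B x) (count-mono-⊆ (λ j e → dec-true (X (z j) x Fin.≟ X i x) (z-agree j x e)))) ⟩
        count (λ j → does (X (y j) x Fin.≟ X i x)) + count (λ j → does (X (z j) x Fin.≟ X i x))
                                                    ≡⟨ sum-splitAt l (λ j → χ (does ([ X ∘ y , X ∘ z ]′ j x Fin.≟ X i x))) ⟨
        count (λ j → does (xs j x Fin.≟ X i x))     ≡⟨ length-filter-tabulate (λ j → xs j x Fin.≟ X i x) id ⟨
        agreeCount xs (X i) x                       <⟨ proj₂ few ⟩
        s                                           ∎)
        where
        open ≤-Reasoning
        r : Fin n → ℕ
        r x = s ∸ degree (lookup ∘ A) x
        -- At most `u` of the `l` sets miss `x`, so the degree is at least `l - u = s - b`.
        r≤b : ∀ x → r x ≤ b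
        r≤b x = m≤n+o⇒m∸n≤o s (degree (lookup ∘ A) x) (+-cancelʳ-≤ u _ _ (begin
          s + u                                    ≡⟨ s+u≡c ⟩
          l + b                                    ≡⟨ cong (_+ b) (count-not (λ j → lookup (A j) x)) ⟨
          degree (lookup ∘ A) x + missed + b       ≤⟨ +-monoˡ-≤ b (+-monoʳ-≤ (degree (lookup ∘ A) x) (proj₂ (bal x))) ⟩
          degree (lookup ∘ A) x + u + b            ≡⟨ +-assoc (degree (lookup ∘ A) x) u b ⟩
          degree (lookup ∘ A) x + (u + b)          ≡⟨ cong (degree (lookup ∘ A) x +_) (+-comm u b) ⟩
          degree (lookup ∘ A) x + (b + u)          ≡⟨ +-assoc (degree (lookup ∘ A) x) b u ⟨
          degree (lookup ∘ A) x + b + u            ∎))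
          where missed = count (λ j → not (lookup (A j) x))
        Σdegree : sum (degree (lookup ∘ A)) ≡ l * suc t
        Σdegree = trans (∑-comm (λ x j → χ (lookup (A j) x)))
          (trans (sum-cong-≗ (λ j → trans (sym (∣-∣≡count (A j))) (|A| j))) (sum-const l (suc t)))
        -- The `l` sets have `l (t + 1)` points in all, which leaves `s n - l (t + 1) = b t`.
        Σr : sum r ≤ b * t
        Σr = +-cancelˡ-≤ (l * suc t) _ _ (≤-reflexive (begin-equality
          l * suc t + sum r                              ≡⟨ cong (_+ sum r) Σdegree ⟨
          sum (degree (lookup ∘ A)) + sum r              ≡⟨ ∑-distrib-+ (degree (lookup ∘ A)) r ⟨
          sum (λ x → degree (lookup ∘ A) x + r x)        ≡⟨ sum-cong-≗ (λ x → m+[n∸m]≡n (proj₁ (bal x))) ⟩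
          sum {n} (λ _ → s)                              ≡⟨ sum-const n s ⟩
          n * s                                          ≡⟨ *-comm n s ⟩
          s * n                                          ≡⟨ sn≡ct+l ⟩
          (l + b) * t + l                                ≡⟨ cong (_+ l) (*-distribʳ-+ t l b) ⟩
          l * t + b * t + l                              ≡⟨ +-comm (l * t + b * t) l ⟩
          l + (l * t + b * t)                            ≡⟨ +-assoc l (l * t) (b * t) ⟨
          l + l * t + b * t                              ≡⟨ cong (_+ b * t) (*-suc l t) ⟨
          l * suc t + b * t                              ∎))
        arranged = arrange b t r r≤b Σr
        B = proj₁ arranged
        r≤B = proj₂ (proj₂ arranged)
        sharedB : ∀ j → _
        sharedB j = small-shared (B j) (proj₁ (proj₂ arranged) j)
        y : Fin l → Fin N
        y j = proj₁ (sharedA j)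
        y-agree : ∀ j x → lookup (A j) x ≡ true → X (y j) x ≡ X i x
        y-agree j x e = proj₂ (proj₂ (sharedA j)) x (lookup⇒[]= x (A j) e)
        z : Fin b → Fin N
        z j = proj₁ (sharedB j)
        z-agree : ∀ j x → B j x ≡ true → X (z j) x ≡ X i x
        z-agree j = proj₂ (proj₂ (sharedB j))
        xs : Fin (l + b) → Word q n
        xs j = [ X ∘ y , X ∘ z ]′ (splitAt l j)
        other : ∀ j → ∃[ k ] k ≢ i × xs j ≡ X k
        other j with splitAt l j
        ... | inj₁ j₁ = y j₁ , proj₁ (proj₂ (sharedA j₁)) , refl
        ... | inj₂ j₂ = z j₂ , proj₁ (proj₂ (sharedB j₂)) , refl
        few = frameproof (X i) (∈-lookup i) xs
          (λ j → let k , _ , e = other j in subst (_∈ᴸ C) (sym e) (∈-lookup k))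
          (λ j e → let k , k≢i , e' = other j in k≢i (sym (lookup-injective C! (trans e e'))))
        x = proj₁ few

    module _ (m : ℕ) (max : (F : List (Subset n)) → Unique F →
                            IsGoodFamily n (suc t) l (s + 1) (u + 1) F → length F ≤ m) where

      K K₀ M : ℕ
      K  = length (subsetsOfSize n (suc t))
      K₀ = length (subsetsOfSize n t)
      M  = K ∸ m

      large : Fin K → Subset n
      large = List.lookup (subsetsOfSize n (suc t))
      small : Fin K₀ → Subset n
      small = List.lookup (subsetsOfSize n t)

      -- The weight `M` puts both kinds of codewords into one inequality: a single own set of size
      -- `t` already contributes `M`. Without one, the shared sets of size `suc t` form a good
      -- family by `no-balanced`, so at most `m` of them exist and the others are own.
      enough-own : ∀ i → M ≤ count (own i ∘ large) + M * count (own i ∘ small)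
      enough-own i with count (own i ∘ small) in eq
      ... | suc k = ≤-trans (m≤m+n M _) (≤-trans (≤-reflexive (sym (*-suc M k))) (m≤n+m _ _))
      ... | zero  = ≤-trans (m≤n+o⇒m∸n≤o K m (begin
        K                                                           ≡⟨ count-not (own i ∘ large) ⟨
        count (own i ∘ large) + count (not ∘ own i ∘ large)         ≡⟨ +-comm _ (count (not ∘ own i ∘ large)) ⟩
        count (not ∘ own i ∘ large) + count (own i ∘ large)         ≡⟨ cong (_+ count (own i ∘ large)) F-length ⟨
        length F + count (own i ∘ large)                            ≤⟨ +-monoˡ-≤ _ (max F F! F-good) ⟩
        m + count (own i ∘ large)                                   ∎)) (m≤m+n _ _)
        where
        open ≤-Reasoning
        F : List (Subset n)
        F = filter (shared? i) (subsetsOfSize n (suc t))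
        F! : Unique F
        F! = Unique.filter⁺ (shared? i) (subsetsOfSize-! n (suc t))
        F-length : length F ≡ count (not ∘ own i ∘ large)
        F-length = trans (length-filter (shared? i) (subsetsOfSize n (suc t)))
          (sum-cong-≗ λ j → cong χ (sym (Bool.not-involutive (does (shared? i (large j))))))
        all-shared : ∀ T → ∣ T ∣ ≡ t → Shared i T
        all-shared T refl = witness (shared? i T) (χ-injective (+-cancelʳ-≡ (χ (own i T)) _ _ (trans
          (χ-not (does (shared? i T))) (cong suc (sym own≡0)))))
          where
          T∈ = ∈-subsetsOfSize⁺ T
          -- This indicator is one term of the count of small own sets, which is zero in this case.
          own≡0 : χ (own i T) ≡ 0
          own≡0 = n≤0⇒n≡0 (≤-trans (≤-reflexive (cong (χ ∘ own i) (lookup-index T∈)))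
            (≤-trans (≤sum (χ ∘ own i ∘ small) (index T∈)) (≤-reflexive eq)))
        F-good : IsGoodFamily n (suc t) l (s + 1) (u + 1) F
        F-good = size , λ A A∈F (disj , cov) →
          no-balanced i all-shared A (λ j → size (A∈F j))
            (λ j → proj₂ (∈-filter⁻ (shared? i) {xs = subsetsOfSize n (suc t)} (A∈F j)))
            (KDisjoint∧KCovering⇒Balanced A disj cov)
          where
          size : ∀ {A} → A ∈ᴸ F → ∣ A ∣ ≡ suc t
          size A∈F = ∈-subsetsOfSize⁻ n (suc t) (proj₁ (∈-filter⁻ (shared? i) A∈F))

      count-own-family : ∀ {k} r (T : Fin k → Subset n) → (∀ j → ∣ T j ∣ ≡ r) →
                         sum (λ i → count (own i ∘ T)) ≤ k * q ^ r
      count-own-family {k} r T |T| = begin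
        sum (λ i → count (own i ∘ T))        ≡⟨ ∑-comm (λ i j → χ (own i (T j))) ⟩
        sum (λ j → count (λ i → own i (T j))) ≤⟨ sum-mono (λ j → ≤-trans (count-own (T j)) (≤-reflexive (cong (q ^_) (|T| j)))) ⟩
        sum {k} (λ _ → q ^ r)                ≡⟨ sum-const k (q ^ r) ⟩
        k * q ^ r                            ∎
        where open ≤-Reasoning

      -- Double counting of pairs of a codeword and an own set of it, with weight `M` on the smaller
      -- sets.
      upper-bound : N * M ≤ K * q ^ suc t + M * (K₀ * q ^ t)
      upper-bound = begin
        N * M                                                          ≡⟨ sum-const N M ⟨
        sum {N} (λ _ → M)                                              ≤⟨ sum-mono enough-own ⟩
        sum (λ i → count (own i ∘ large) + M * count (own i ∘ small))  ≡⟨ ∑-distrib-+ (λ i → count (own i ∘ large)) _ ⟩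
        sum (λ i → count (own i ∘ large)) + sum (λ i → M * count (own i ∘ small))
          ≡⟨ cong (sum (λ i → count (own i ∘ large)) +_) (*-distribˡ-sum M (λ i → count (own i ∘ small))) ⟨
        sum (λ i → count (own i ∘ large)) + M * sum (λ i → count (own i ∘ small))
          ≤⟨ +-mono-≤ (count-own-family (suc t) large (λ j → ∈-subsetsOfSize⁻ n (suc t) (∈-lookup j)))
               (*-monoʳ-≤ M (count-own-family t small (λ j → ∈-subsetsOfSize⁻ n t (∈-lookup j)))) ⟩
        K * q ^ suc t + M * (K₀ * q ^ t)                               ∎
        where open ≤-Reasoning

  -- Permutations acting on subsets.

  sum-zero : ∀ {n} {f : Fin n → ℕ} → (∀ i → f i ≡ 0) → sum f ≡ 0
  sum-zero {n} f≡0 = trans (sum-cong-≗ f≡0) (trans (sum-const n 0) (*-zeroʳ n))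

  sum-single : ∀ {n} (f : Fin n → ℕ) i → (∀ j → j ≢ i → f j ≡ 0) → sum f ≡ f i
  sum-single f zero    f≡0 = trans (cong (f zero +_) (sum-zero (λ j → f≡0 (suc j) λ ()))) (+-identityʳ _)
  sum-single f (suc i) f≡0 = trans (cong (_+ sum (f ∘ suc)) (f≡0 zero λ ()))
    (sum-single (f ∘ suc) i (λ j j≢i → f≡0 (suc j) (j≢i ∘ Fin.suc-injective)))

  sum-remQuot : ∀ m k (h : Fin m × Fin k → ℕ) →
                sum (λ i → h (remQuot k i)) ≡ sum (λ i → sum (λ j → h (i , j)))
  sum-remQuot zero    k h = refl
  sum-remQuot (suc m) k h =
    trans (sum-cong-≗ split)
    (trans (sum-splitAt k [ (λ j → h (zero , j)) , (λ i → h (Product.map₁ suc (remQuot k i))) ]′)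
           (cong (sum (λ j → h (zero , j)) +_) (sum-remQuot m k (h ∘ Product.map₁ suc))))
    where
    split : ∀ i → h (remQuot {suc m} k i) ≡ [ (λ j → h (zero , j)) , (λ i → h (Product.map₁ suc (remQuot k i))) ]′ (splitAt k i)
    split i with splitAt k i
    ... | inj₁ j = refl
    ... | inj₂ j = refl

  _≟ˢ_ : ∀ {n} (p q : Subset n) → Dec (p ≡ q)
  _≟ˢ_ = ≡-dec Bool._≟_

  -- The n ! permutations, numbered by Lehmer code.
  permute : ∀ n → Fin (n !) → Subset n → Subset n
  permute zero    _ p = p
  permute (suc n) σ p =
    let i , τ = remQuot (n !) σ in lookup p i ∷ permute n τ (removeAt p i)

  -- The point map that induces `permute n σ`; conditions checked point by point, such as
  -- `Balanced`, are transported along it.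
  source : ∀ n → Fin (n !) → Fin n → Fin n
  source (suc n) σ zero    = proj₁ (remQuot (n !) σ)
  source (suc n) σ (suc x) =
    let i , τ = remQuot (n !) σ in punchIn i (source n τ x)

  lookup-removeAt : ∀ {n} (p : Subset (suc n)) i x → lookup (removeAt p i) x ≡ lookup p (punchIn i x)
  lookup-removeAt (b ∷ p)     zero    x       = refl
  lookup-removeAt (b ∷ c ∷ p) (suc i) zero    = refl
  lookup-removeAt (b ∷ c ∷ p) (suc i) (suc x) = lookup-removeAt (c ∷ p) i x

  lookup-permute : ∀ n (σ : Fin (n !)) p x → lookup (permute n σ p) x ≡ lookup p (source n σ x)
  lookup-permute (suc n) σ p zero    = refl
  lookup-permute (suc n) σ p (suc x) =
    let i , τ = remQuot (n !) σ in
    trans (lookup-permute n τ (removeAt p i) x) (lookup-removeAt p i (source n τ x))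

  ∣removeAt∣ : ∀ {n} (p : Subset (suc n)) i → χ (lookup p i) + ∣ removeAt p i ∣ ≡ ∣ p ∣
  ∣removeAt∣ (true  ∷ p)         zero    = refl
  ∣removeAt∣ (false ∷ p)         zero    = refl
  ∣removeAt∣ (true  ∷ p@(_ ∷ _)) (suc i) = trans (+-suc (χ (lookup p i)) _) (cong suc (∣removeAt∣ p i))
  ∣removeAt∣ (false ∷ p@(_ ∷ _)) (suc i) = ∣removeAt∣ p i

  ∣∷∣ : ∀ {n} b (p : Subset n) → ∣ b ∷ p ∣ ≡ χ b + ∣ p ∣
  ∣∷∣ true  p = refl
  ∣∷∣ false p = refl

  ∣permute∣ : ∀ n (σ : Fin (n !)) p → ∣ permute n σ p ∣ ≡ ∣ p ∣
  ∣permute∣ zero    σ p = refl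
  ∣permute∣ (suc n) σ p =
    let i , τ = remQuot (n !) σ in
    trans (∣∷∣ (lookup p i) (permute n τ (removeAt p i))) (trans (cong (χ (lookup p i) +_) (∣permute∣ n τ (removeAt p i))) (∣removeAt∣ p i))

  stabilizerSize : ℕ → ℕ → ℕ
  stabilizerSize n t = t ! * (n ∸ t) !

  -- The first entry must come from a position of `p` with bit `b`. There are `suc ∣ q ∣` such
  -- positions if `b` is true and `suc (n ∸ ∣ q ∣)` otherwise, and this number extends one of the
  -- two factorials.
  count-≟ : ∀ n (p : Subset (suc n)) b (q : Subset n) → ∣ p ∣ ≡ ∣ b ∷ q ∣ →
            count (λ i → does (lookup p i Bool.≟ b)) * stabilizerSize n ∣ q ∣ ≡ stabilizerSize (suc n) ∣ b ∷ q ∣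
  count-≟ n p true q |p| = begin
    count (λ i → does (lookup p i Bool.≟ true)) * stabilizerSize n ∣ q ∣  ≡⟨ cong (_* stabilizerSize n ∣ q ∣) (sum-cong-≗ (λ i → cong χ (≟true (lookup p i)))) ⟩
    count (lookup p) * stabilizerSize n ∣ q ∣        ≡⟨ cong (_* stabilizerSize n ∣ q ∣) (trans (sym (∣-∣≡count p)) |p|) ⟩
    suc ∣ q ∣ * (∣ q ∣ ! * (n ∸ ∣ q ∣) !)      ≡⟨ *-assoc (suc ∣ q ∣) (∣ q ∣ !) _ ⟨
    suc ∣ q ∣ ! * (n ∸ ∣ q ∣) !                ∎
    where
    open ≡-Reasoning
    ≟true : ∀ b → does (b Bool.≟ true) ≡ b
    ≟true true  = refl
    ≟true false = refl
  count-≟ n p false q |p| = begin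
    count (λ i → does (lookup p i Bool.≟ false)) * stabilizerSize n ∣ q ∣  ≡⟨ cong (_* stabilizerSize n ∣ q ∣) (sum-cong-≗ (λ i → cong χ (≟false (lookup p i)))) ⟩
    count (not ∘ lookup p) * stabilizerSize n ∣ q ∣                ≡⟨ cong (_* stabilizerSize n ∣ q ∣) zeros ⟩
    suc (n ∸ ∣ q ∣) * (∣ q ∣ ! * (n ∸ ∣ q ∣) !)              ≡⟨ *-assoc (suc (n ∸ ∣ q ∣)) (∣ q ∣ !) _ ⟨
    suc (n ∸ ∣ q ∣) * ∣ q ∣ ! * (n ∸ ∣ q ∣) !                ≡⟨ cong (_* (n ∸ ∣ q ∣) !) (*-comm (suc (n ∸ ∣ q ∣)) (∣ q ∣ !)) ⟩
    ∣ q ∣ ! * suc (n ∸ ∣ q ∣) * (n ∸ ∣ q ∣) !                ≡⟨ *-assoc (∣ q ∣ !) (suc (n ∸ ∣ q ∣)) _ ⟩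
    ∣ q ∣ ! * suc (n ∸ ∣ q ∣) !                              ≡⟨ cong (λ k → ∣ q ∣ ! * k !) (+-∸-assoc 1 |q|≤n) ⟨
    ∣ q ∣ ! * (suc n ∸ ∣ q ∣) !                              ∎
    where
    open ≡-Reasoning
    |q|≤n : ∣ q ∣ ≤ n
    |q|≤n = ∣p∣≤n q
    ≟false : ∀ b → does (b Bool.≟ false) ≡ not b
    ≟false true  = refl
    ≟false false = refl
    zeros : count (not ∘ lookup p) ≡ suc (n ∸ ∣ q ∣)
    zeros = trans (sym (m+n∸m≡n (count (lookup p)) _)) (trans (cong₂ _∸_ (count-not (lookup p)) (trans (sym (∣-∣≡count p)) |p|)) (+-∸-assoc 1 |q|≤n))

  -- Induction along the Lehmer code: the first digit must point to a position with the right bit,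
  -- and the other digits permute what is left after its removal.
  count-permute : ∀ n (p q : Subset n) → ∣ p ∣ ≡ ∣ q ∣ →
                  count (λ σ → does (permute n σ p ≟ˢ q)) ≡ stabilizerSize n ∣ q ∣
  count-permute zero    []  []      _   = refl
  count-permute (suc n) p   (b ∷ q) |p| = begin
    count (λ σ → does (permute (suc n) σ p ≟ˢ (b ∷ q)))
      ≡⟨ sum-remQuot (suc n) (n !) (λ (i , τ) → χ (does ((lookup p i ∷ permute n τ (removeAt p i)) ≟ˢ (b ∷ q)))) ⟩
    sum (λ i → count (λ τ → does ((lookup p i ∷ permute n τ (removeAt p i)) ≟ˢ (b ∷ q))))
      ≡⟨ sum-cong-≗ first ⟩
    sum (λ i → χ (does (lookup p i Bool.≟ b)) * stabilizerSize n ∣ q ∣)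
      ≡⟨ *-distribʳ-sum (stabilizerSize n ∣ q ∣) (λ i → χ (does (lookup p i Bool.≟ b))) ⟨
    count (λ i → does (lookup p i Bool.≟ b)) * stabilizerSize n ∣ q ∣
      ≡⟨ count-≟ n p b q |p| ⟩
    stabilizerSize (suc n) ∣ b ∷ q ∣ ∎
    where
    open ≡-Reasoning
    first : ∀ i → count (λ τ → does ((lookup p i ∷ permute n τ (removeAt p i)) ≟ˢ (b ∷ q))) ≡
                  χ (does (lookup p i Bool.≟ b)) * stabilizerSize n ∣ q ∣
    first i with lookup p i Bool.≟ b
    ... | no  _  = sum-zero {n !} (λ _ → refl)
    ... | yes ≡b = begin
      count (λ τ → does (permute n τ (removeAt p i) ≟ˢ q))
        ≡⟨ count-permute n (removeAt p i) q (+-cancelˡ-≡ (χ b) _ _ (trans (trans (cong (λ c → χ c + ∣ removeAt p i ∣) (sym ≡b)) (∣removeAt∣ p i)) (trans |p| (∣∷∣ b q)))) ⟩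
      stabilizerSize n ∣ q ∣
        ≡⟨ +-identityʳ _ ⟨
      1 * stabilizerSize n ∣ q ∣ ∎

  -- Every `t`-set is the image of `p` equally often, so a property holds for the images of `p` in
  -- the same proportion as for all `t`-sets.
  count-orbit : ∀ n t (H : Subset n → Bool) (p : Subset n) → ∣ p ∣ ≡ t →
                count (λ σ → H (permute n σ p)) ≡ count (H ∘ List.lookup (subsetsOfSize n t)) * stabilizerSize n t
  count-orbit n t H p |p| = begin
    count (λ σ → H (permute n σ p))
      ≡⟨ sum-cong-≗ single ⟩
    sum (λ σ → sum (λ j → χ (H (T j)) * χ (does (permute n σ p ≟ˢ T j))))
      ≡⟨ ∑-comm (λ σ j → χ (H (T j)) * χ (does (permute n σ p ≟ˢ T j))) ⟩
    sum (λ j → sum (λ σ → χ (H (T j)) * χ (does (permute n σ p ≟ˢ T j))))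
      ≡⟨ sum-cong-≗ (λ j → sym (*-distribˡ-sum (χ (H (T j))) (λ σ → χ (does (permute n σ p ≟ˢ T j))))) ⟩
    sum (λ j → χ (H (T j)) * count (λ σ → does (permute n σ p ≟ˢ T j)))
      ≡⟨ sum-cong-≗ (λ j → cong (χ (H (T j)) *_) (trans (count-permute n p (T j) (trans |p| (sym (|T| j)))) (cong (stabilizerSize n) (|T| j)))) ⟩
    sum (λ j → χ (H (T j)) * stabilizerSize n t)
      ≡⟨ *-distribʳ-sum (stabilizerSize n t) (χ ∘ H ∘ T) ⟨
    count (H ∘ T) * stabilizerSize n t ∎
    where
    open ≡-Reasoning
    T = List.lookup (subsetsOfSize n t)
    |T| : ∀ j → ∣ T j ∣ ≡ t
    |T| j = ∈-subsetsOfSize⁻ n t (∈-lookup j)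
    single : ∀ σ → χ (H (permute n σ p)) ≡ sum (λ j → χ (H (T j)) * χ (does (permute n σ p ≟ˢ T j)))
    single σ = sym (begin
      sum (λ j → χ (H (T j)) * χ (does (permute n σ p ≟ˢ T j)))
        ≡⟨ sum-single _ i (λ j j≢i → trans (cong (λ b → χ (H (T j)) * χ b) (dec-false (permute n σ p ≟ˢ T j) λ eq →
             j≢i (lookup-injective (subsetsOfSize-! n t) (trans (sym eq) Ti)))) (*-zeroʳ (χ (H (T j))))) ⟩
      χ (H (T i)) * χ (does (permute n σ p ≟ˢ T i))
        ≡⟨ cong₂ _*_ (cong (χ ∘ H) (sym Ti)) (cong χ (dec-true (permute n σ p ≟ˢ T i) Ti)) ⟩
      χ (H (permute n σ p)) * 1
        ≡⟨ *-identityʳ _ ⟩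
      χ (H (permute n σ p)) ∎)
      where
      ∈T = subst (λ k → permute n σ p ∈ᴸ (subsetsOfSize n k)) (trans (∣permute∣ n σ p) |p|) (∈-subsetsOfSize⁺ (permute n σ p))
      i = index ∈T
      Ti : permute n σ p ≡ T i
      Ti = lookup-index ∈T

-- Polynomials modulo p and subset sums of powers of two.

module Polynomials where

  open Counting using (χ; χ≤1)
  open import Data.Bool.Base using (true; false)
  open import Data.Fin.Base using (Fin; zero; suc; toℕ)
  import Data.Fin.Properties as Fin
  open import Data.Fin.Subset using (Subset; _∈_; ∣_∣)
  open import Data.Integer.Base as ℤ using (ℤ; +_; 0ℤ; 1ℤ; _+_; _*_; _-_; _^_)
  import Data.Integer.Properties as ℤ
  open import Data.Integer.DivMod using (_%ℕ_; _/ℕ_; a≡a%ℕn+[a/ℕn]*n)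
  open import Data.Integer.Divisibility.Signed
    using (_∣_; divides; ∣m∣n⇒∣m-n; ∣m+n∣m⇒∣n; ∣m+n∣n⇒∣m; ∣n⇒∣m*n; ∣m⇒∣m*n; ∣⇒∣ᵤ; ∣ᵤ⇒∣)
  open import Data.Integer.Tactic.RingSolver using (solve-∀)
  open import Data.Nat.Base as ℕ using (ℕ; zero; suc; _!; _<_; z≤n; s≤s)
  import Data.Nat.Divisibility as ℕ
  import Data.Nat.Properties as ℕ
  open import Data.Vec.Base using (Vec; []; _∷_; here; there; zipWith)
  open import Data.Vec.Relation.Unary.All using (All; []; _∷_)
  open import Function.Base using (_∘_)
  open import Relation.Binary.PropositionalEquality
  open import Relation.Nullary using (yes; no; contradiction)

  -- The polynomial b x^k + c₁ x^(k−1) + … + c_k, by Horner's rule.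
  eval : ∀ {k} → ℤ → Vec ℤ k → ℤ → ℤ
  eval b []       x = b
  eval b (c ∷ cs) x = eval (b * x + c) cs x

  -- Synthetic division by x − r; the leading coefficient of the quotient is again b and is left implicit.
  quotient : ∀ {k} → ℤ → ℤ → Vec ℤ (suc k) → Vec ℤ k
  quotient r b (c ∷ [])         = []
  quotient r b (c ∷ cs@(_ ∷ _)) = (b * r + c) ∷ quotient r (b * r + c) cs

  eval-+ : ∀ {k} u v (cs : Vec ℤ k) x → eval (u + v) cs x ≡ u * x ^ k + eval v cs x
  eval-+ u v []       x = cong (_+ v) (sym (ℤ.*-identityʳ u))
  eval-+ {suc k} u v (c ∷ cs) x = begin
    eval ((u + v) * x + c) cs x           ≡⟨ cong (λ w → eval w cs x) (regroup u v x c) ⟩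
    eval (u * x + (v * x + c)) cs x       ≡⟨ eval-+ (u * x) (v * x + c) cs x ⟩
    u * x * x ^ k + eval (v * x + c) cs x ≡⟨ cong (_+ eval (v * x + c) cs x) (ℤ.*-assoc u x (x ^ k)) ⟩
    u * (x * x ^ k) + eval (v * x + c) cs x ∎
    where
    open ≡-Reasoning
    regroup : ∀ u v x c → (u + v) * x + c ≡ u * x + (v * x + c)
    regroup = solve-∀

  eval-quotient : ∀ {k} b (cs : Vec ℤ (suc k)) r x →
                  eval b cs x ≡ (x - r) * eval b (quotient r b cs) x + eval b cs r
  eval-quotient b (c ∷ []) r x = linear b c r x
    where
    linear : ∀ b c r x → b * x + c ≡ (x - r) * b + (b * r + c)
    linear = solve-∀
  eval-quotient {suc k} b (c ∷ cs@(_ ∷ _)) r x = begin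
    -- Writing `b * x + c` as `b * (x - r) + b'` splits off a multiple of `x - r`, and `b'` starts
    -- the division of the remaining coefficients.
    eval (b * x + c) cs x                                    ≡⟨ cong (λ w → eval w cs x) (shift b c r x) ⟩
    eval (b * (x - r) + b') cs x                             ≡⟨ eval-+ (b * (x - r)) b' cs x ⟩
    b * (x - r) * (x * x ^ k) + eval b' cs x                 ≡⟨ cong (λ w → b * (x - r) * (x * x ^ k) + w) (eval-quotient b' cs r x) ⟩
    b * (x - r) * (x * x ^ k) + ((x - r) * eval b' q x + eval b' cs r)
                                                             ≡⟨ collect b (x - r) x (x ^ k) (eval b' q x) (eval b' cs r) ⟩
    (x - r) * (b * x * x ^ k + eval b' q x) + eval b' cs r   ≡⟨ cong (λ w → (x - r) * w + eval b' cs r) (eval-+ (b * x) b' q x) ⟨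
    (x - r) * eval (b * x + b') q x + eval b' cs r           ∎
    where
    open ≡-Reasoning
    b' = b * r + c
    q = quotient r b' cs
    shift : ∀ b c r x → b * x + c ≡ b * (x - r) + (b * r + c)
    shift = solve-∀
    collect : ∀ b d x y e f → b * d * (x * y) + (d * e + f) ≡ d * (b * x * y + e) + f
    collect = solve-∀

  eval-minus : ∀ {k} b b' (cs cs' : Vec ℤ k) x →
               eval b cs x - eval b' cs' x ≡ eval (b - b') (zipWith _-_ cs cs') x
  eval-minus b b' []       []         x = refl
  eval-minus b b' (c ∷ cs) (c' ∷ cs') x =
    trans (eval-minus (b * x + c) (b' * x + c') cs cs' x)
          (cong (λ w → eval w (zipWith _-_ cs cs') x) (regroup b b' x c c'))
    where
    regroup : ∀ b b' x c c' → b * x + c - (b' * x + c') ≡ (b - b') * x + (c - c')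
    regroup = solve-∀

  subsetSum : ∀ {n} → (Fin n → ℤ) → Subset n → ℤ
  subsetSum α []          = 0ℤ
  subsetSum α (true  ∷ T) = α zero + subsetSum (α ∘ suc) T
  subsetSum α (false ∷ T) = subsetSum (α ∘ suc) T

  module Mod (p : ℤ) where

    -- Cancellability modulo `p`. It takes the place of invertibility in a field, as the modulus
    -- chosen below may be composite.
    Regular : ℤ → Set
    Regular d = ∀ a → p ∣ d * a → p ∣ a

    quotient-root : ∀ {k} b (cs : Vec ℤ (suc k)) r x → Regular (x - r) →
                    p ∣ eval b cs r → p ∣ eval b cs x → p ∣ eval b (quotient r b cs) x
    quotient-root b cs r x reg pr px =
      reg _ (∣m+n∣n⇒∣m (subst (p ∣_) (eval-quotient b cs r x) px) pr)

    Separated : ∀ {n} → (Fin n → ℤ) → Set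
    Separated α = ∀ i j → i ≢ j → Regular (α i - α j)

    Roots : ∀ {n k} → (Fin n → ℤ) → Subset n → ℤ → Vec ℤ k → Set
    Roots α T b cs = ∀ i → i ∈ T → p ∣ eval b cs (α i)

    quotient-roots : ∀ {n k} (α : Fin (suc n) → ℤ) → Separated α → (T : Subset n) → ∀ b (cs : Vec ℤ (suc k)) →
                     Roots α (true ∷ T) b cs → Roots (α ∘ suc) T b (quotient (α zero) b cs)
    quotient-roots α sep T b cs roots i i∈T =
      quotient-root b cs (α zero) (α (suc i)) (sep (suc i) zero λ ()) (roots zero here) (roots (suc i) (there i∈T))

    tail-separated : ∀ {n} (α : Fin (suc n) → ℤ) → Separated α → Separated (α ∘ suc)
    tail-separated α sep i j i≢j = sep (suc i) (suc j) (i≢j ∘ Fin.suc-injective)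

    -- Degree and number of roots are both `suc k`. Dividing by `x - r` replaces `c` by `b * r + c`
    -- and moves one root out of the sum, until the polynomial is linear.
    vieta : ∀ {n k} (α : Fin n → ℤ) → Separated α → (T : Subset n) → ∣ T ∣ ≡ suc k →
            ∀ b c (cs : Vec ℤ k) → Roots α T b (c ∷ cs) → p ∣ c + b * subsetSum α T
    vieta α sep (false ∷ T) |T| b c cs roots =
      vieta (α ∘ suc) (tail-separated α sep) T |T| b c cs (λ i i∈T → roots (suc i) (there i∈T))
    vieta α sep (true ∷ T) |T| b c [] roots =
      subst (p ∣_) (begin
        b * α zero + c                                  ≡⟨ swap b (α zero) c ⟩
        c + b * (α zero + 0ℤ)                           ≡⟨ cong (λ w → c + b * (α zero + w)) (empty (α ∘ suc) T (ℕ.suc-injective |T|)) ⟨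
        c + b * (α zero + subsetSum (α ∘ suc) T)        ∎) (roots zero here)
      where
      open ≡-Reasoning
      swap : ∀ b r c → b * r + c ≡ c + b * (r + 0ℤ)
      swap = solve-∀
      empty : ∀ {n} (α : Fin n → ℤ) T → ∣ T ∣ ≡ 0 → subsetSum α T ≡ 0ℤ
      empty α []          _   = refl
      empty α (false ∷ T) |T| = empty (α ∘ suc) T |T|
    vieta α sep (true ∷ T) |T| b c cs@(_ ∷ _) roots =
      subst (p ∣_) (regroup b c (α zero) (subsetSum (α ∘ suc) T))
        (vieta (α ∘ suc) (tail-separated α sep) T (ℕ.suc-injective |T|) b (b * α zero + c) (quotient (α zero) (b * α zero + c) cs)
          (quotient-roots α sep T b (c ∷ cs) roots))
      where
      regroup : ∀ b c r s → b * r + c + b * s ≡ c + b * (r + s)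
      regroup = solve-∀

    -- Synthetic division read backwards: each coefficient is a quotient coefficient minus `r` times
    -- the previous one, and the last comes from the remainder.
    quotient-zero : ∀ {k} r b (cs : Vec ℤ (suc k)) → p ∣ b → All (p ∣_) (quotient r b cs) →
                    p ∣ eval b cs r → All (p ∣_) cs
    quotient-zero r b (c ∷ [])         pb []        pr = ∣m+n∣m⇒∣n pr (∣m⇒∣m*n r pb) ∷ []
    quotient-zero r b (c ∷ cs@(_ ∷ _)) pb (pq ∷ pqs) pr =
      ∣m+n∣m⇒∣n pq (∣m⇒∣m*n r pb) ∷ quotient-zero r (b * r + c) cs pq pqs pr

    -- Modulo `p` the degree is below `k`, yet there are `k` roots. Dividing them out one at a time
    -- leaves the constant `b`, and `quotient-zero` leads back up.
    vanishing : ∀ {n k} (α : Fin n → ℤ) → Separated α → (T : Subset n) → ∣ T ∣ ≡ k →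
                ∀ b (cs : Vec ℤ k) → p ∣ b → Roots α T b cs → All (p ∣_) cs
    vanishing α sep []          |T| b []       pb roots = []
    vanishing α sep (false ∷ T) |T| b cs       pb roots =
      vanishing (α ∘ suc) (tail-separated α sep) T |T| b cs pb (λ i i∈T → roots (suc i) (there i∈T))
    vanishing α sep (true ∷ T)  |T| b (c ∷ cs) pb roots =
      quotient-zero (α zero) b (c ∷ cs) pb
        (vanishing (α ∘ suc) (tail-separated α sep) T (ℕ.suc-injective |T|) b (quotient (α zero) b (c ∷ cs)) pb
          (quotient-roots α sep T b (c ∷ cs) roots))
        (roots zero here)

  powers : ∀ n → Fin n → ℤ
  powers n i = + (2 ℕ.^ toℕ i)

  -- `T` read as a binary numeral, least significant digit first; hence the bound `2 ^ n` and
  -- injectivity.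
  binary : ∀ {n} → Subset n → ℕ
  binary []      = 0
  binary (b ∷ T) = χ b ℕ.+ 2 ℕ.* binary T

  subsetSum-scale : ∀ {n} a (α : Fin n → ℤ) T → subsetSum (λ i → a * α i) T ≡ a * subsetSum α T
  subsetSum-scale a α []          = sym (ℤ.*-zeroʳ a)
  subsetSum-scale a α (true  ∷ T) = trans (cong (λ w → a * α zero + w) (subsetSum-scale a (α ∘ suc) T)) (sym (ℤ.*-distribˡ-+ a _ _))
  subsetSum-scale a α (false ∷ T) = subsetSum-scale a (α ∘ suc) T

  subsetSum-cong : ∀ {n} {α β : Fin n → ℤ} → (∀ i → α i ≡ β i) → ∀ T → subsetSum α T ≡ subsetSum β T
  subsetSum-cong α≡β []          = refl
  subsetSum-cong α≡β (true  ∷ T) = cong₂ _+_ (α≡β zero) (subsetSum-cong (α≡β ∘ suc) T)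
  subsetSum-cong α≡β (false ∷ T) = subsetSum-cong (α≡β ∘ suc) T

  subsetSum-powers : ∀ n (T : Subset n) → subsetSum (powers n) T ≡ + binary T
  subsetSum-powers zero    []      = refl
  subsetSum-powers (suc n) (b ∷ T) = trans (head b) (cong (λ w → + χ b + w) (begin
    subsetSum (powers (suc n) ∘ suc) T       ≡⟨ subsetSum-cong (λ i → ℤ.pos-* 2 (2 ℕ.^ toℕ i)) T ⟩
    subsetSum (λ i → + 2 * powers n i) T     ≡⟨ subsetSum-scale (+ 2) (powers n) T ⟩
    + 2 * subsetSum (powers n) T             ≡⟨ cong (λ w → + 2 * w) (subsetSum-powers n T) ⟩
    + 2 * + binary T                         ≡⟨ ℤ.pos-* 2 (binary T) ⟨
    + (2 ℕ.* binary T)                       ∎))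
    where
    open ≡-Reasoning
    head : ∀ b → subsetSum (powers (suc n)) (b ∷ T) ≡ + χ b + subsetSum (powers (suc n) ∘ suc) T
    head true  = refl
    head false = sym (ℤ.+-identityˡ _)

  binary<2^n : ∀ {n} (T : Subset n) → binary T < 2 ℕ.^ n
  binary<2^n []          = s≤s z≤n
  binary<2^n {suc n} (b ∷ T) = begin-strict
    χ b ℕ.+ 2 ℕ.* binary T        <⟨ s≤s (ℕ.+-monoˡ-≤ _ (χ≤1 b)) ⟩
    2 ℕ.+ 2 ℕ.* binary T          ≡⟨ ℕ.*-suc 2 (binary T) ⟨
    2 ℕ.* suc (binary T)          ≤⟨ ℕ.*-monoʳ-≤ 2 (binary<2^n T) ⟩
    2 ℕ.* 2 ℕ.^ n                 ∎
    where open ℕ.≤-Reasoning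

  binary-injective : ∀ {n} (T T' : Subset n) → binary T ≡ binary T' → T ≡ T'
  binary-injective []          []           _  = refl
  binary-injective (true  ∷ T) (true  ∷ T') eq =
    cong (true ∷_) (binary-injective T T' (ℕ.*-cancelˡ-≡ _ _ 2 (ℕ.suc-injective eq)))
  binary-injective (false ∷ T) (false ∷ T') eq =
    cong (false ∷_) (binary-injective T T' (ℕ.*-cancelˡ-≡ _ _ 2 eq))
  binary-injective (true  ∷ T) (false ∷ T') eq = contradiction (sym eq) (ℕ.even≢odd (binary T') (binary T))
  binary-injective (false ∷ T) (true  ∷ T') eq = contradiction eq (ℕ.even≢odd (binary T) (binary T'))

  ∣-∣<⊔ : ∀ {u v m} → u < m → v < m → ℤ.∣ + u - + v ∣ < m
  ∣-∣<⊔ {u} {v} u<m v<m =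
    ℕ.≤-<-trans (subst (ℕ._≤ u ℕ.⊔ v) (cong ℤ.∣_∣ (sym (ℤ.m-n≡m⊖n u v))) (ℤ.∣m⊝n∣≤m⊔n u v)) (ℕ.⊔-lub u<m v<m)

  ∣-∣≢0 : ∀ {u v} → u ≢ v → ℤ.∣ + u - + v ∣ ≢ 0
  ∣-∣≢0 {u} {v} u≢v eq = u≢v (ℤ.+-injective (ℤ.i-j≡0⇒i≡j (+ u) (+ v) (ℤ.∣i∣≡0⇒i≡0 eq)))

  -- The difference is nonzero and less than `m` in absolute value, so it is up to sign a factor of
  -- the factorial.
  ∣factorial : ∀ {u v m} → u < m → v < m → u ≢ v → + u - + v ∣ + (m !)
  ∣factorial {u} {v} {m} u<m v<m u≢v =
    ∣ᵤ⇒∣ (ℕ.∣-trans (self-divides (∣-∣≢0 u≢v)) (ℕ.m≤n⇒m!∣n! (ℕ.<⇒≤ (∣-∣<⊔ u<m v<m))))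
    where
    self-divides : ∀ {d} → d ≢ 0 → d ℕ.∣ d !
    self-divides {zero}  d≢0 = contradiction refl d≢0
    self-divides {suc d} d≢0 = ℕ.m∣m*n (d !)

  -- With `b = e d` the modulus is `1 + e d k`, so `- e k` is an inverse of `d`.
  regular : ∀ {d b} k → d ∣ + b → Mod.Regular (+ suc (b ℕ.* k)) d
  regular {d} {b} k (divides e b≡e*d) a p∣da =
    subst (+ suc (b ℕ.* k) ∣_) (begin
      a * + suc (b ℕ.* k) - + k * e * (d * a)       ≡⟨ cong (λ w → a * w - + k * e * (d * a)) (trans (ℤ.pos-+ 1 (b ℕ.* k)) (cong (λ w → 1ℤ + w) (trans (ℤ.pos-* b k) (cong (_* + k) b≡e*d)))) ⟩
      a * (1ℤ + e * d * + k) - + k * e * (d * a)    ≡⟨ cancel a e d (+ k) ⟩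
      a                                             ∎)
      (∣m∣n⇒∣m-n (divides a refl) (∣n⇒∣m*n (+ k * e) p∣da))
    where
    open ≡-Reasoning
    cancel : ∀ a e d k → a * (1ℤ + e * d * k) - k * e * (d * a) ≡ a
    cancel = solve-∀

  residues-equal : ∀ {p u v} → u < p → v < p → + p ∣ + u - + v → u ≡ v
  residues-equal {p} {u} {v} u<p v<p p∣u-v with u ℕ.≟ v
  ... | yes u≡v = u≡v
  ... | no  u≢v = contradiction (ℕ.∣⇒≤ {{ℕ.≢-nonZero (∣-∣≢0 u≢v)}} (∣⇒∣ᵤ p∣u-v)) (ℕ.<⇒≱ (∣-∣<⊔ u<p v<p))

  %ℕ-congruent : ∀ p .{{_ : ℕ.NonZero p}} a a' → a %ℕ p ≡ a' %ℕ p → + p ∣ a - a'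
  %ℕ-congruent p a a' eq = divides (a /ℕ p - a' /ℕ p) (begin
    a - a'                                       ≡⟨ cong₂ _-_ (a≡a%ℕn+[a/ℕn]*n a p) (a≡a%ℕn+[a/ℕn]*n a' p) ⟩
    + (a %ℕ p) + (a /ℕ p) * + p - (+ (a' %ℕ p) + (a' /ℕ p) * + p)
                                                 ≡⟨ cong (λ w → + (a %ℕ p) + (a /ℕ p) * + p - (+ w + (a' /ℕ p) * + p)) (sym eq) ⟩
    + (a %ℕ p) + (a /ℕ p) * + p - (+ (a %ℕ p) + (a' /ℕ p) * + p)
                                                 ≡⟨ cancel (+ (a %ℕ p)) (a /ℕ p) (a' /ℕ p) (+ p) ⟩
    (a /ℕ p - a' /ℕ p) * + p                     ∎)
    where
    open ≡-Reasoning
    cancel : ∀ r q q' p → r + q * p - (r + q' * p) ≡ (q - q') * p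
    cancel = solve-∀

-- The algebraic code.

module AlgebraicCode where

  open Counting
  open Subsets
  open Polynomials
  open import Defs
  open import Data.Bool.Base using (Bool; true; false; if_then_else_)
  open import Data.Fin.Base using (Fin; zero; suc; toℕ; combine; remQuot; inject≤; finToFun; funToFin; fromℕ<; punchIn)
  open import Data.Fin.Properties as Fin
    using (toℕ-injective; toℕ<n; finToFun-funToFin; inject≤-injective; toℕ-fromℕ<; punchInᵢ≢i)
  open import Data.Fin.Subset using (Subset; _∈_; ∣_∣)
  open import Data.Integer.Base as ℤ using (ℤ; +_; 0ℤ; _+_; _*_; _-_)
  import Data.Integer.Properties as ℤ
  open import Data.Integer.DivMod using (_%ℕ_; n%ℕd<d)
  open import Data.Integer.Divisibility.Signed using (_∣_; divides; ∣m∣n⇒∣m+n; ∣m+n∣m⇒∣n; ∣m+n∣n⇒∣m; ∣m⇒∣m*n)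
  open import Data.Integer.Tactic.RingSolver using (solve-∀)
  open import Data.Nat.Base as ℕ using (ℕ; zero; suc; _!; _≤_; _<_; z≤n; s≤s)
  import Data.Nat.Properties as ℕ
  open import Data.Product.Base using (∃-syntax; _×_; _,_; proj₁; proj₂)
  open import Data.Vec.Base using (Vec; _∷_; zipWith; tabulate)
  open import Data.Vec.Relation.Unary.All as All using (All)
  open import Data.Vec.Relation.Unary.All.Properties using (lookup⁺)
  open import Data.Vec.Properties using (lookup∘tabulate; lookup-zipWith)
  open import Function.Base using (_∘_)
  open import Relation.Binary.Definitions using (tri<; tri≈; tri>)
  open import Relation.Binary.PropositionalEquality
  open import Relation.Nullary using (yes; no; does; contradiction)
  open import Algebra.Properties.Semiring.Sum ℤ.+-*-semiring using (sum-remove) renaming (sum to sumℤ)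

  -- Numbers the indices satisfying `p` without gaps from zero, which keeps the tags small.
  rank : ∀ {n} → (Fin n → Bool) → Fin n → ℕ
  rank p zero    = 0
  rank p (suc i) = χ (p zero) ℕ.+ rank (p ∘ suc) i

  rank<count : ∀ {n} (p : Fin n → Bool) i → p i ≡ true → rank p i < count p
  rank<count p zero    pi rewrite pi = s≤s z≤n
  rank<count p (suc i) pi = ℕ.+-monoʳ-< (χ (p zero)) (rank<count (p ∘ suc) i pi)

  rank-injective : ∀ {n} (p : Fin n → Bool) i j → p i ≡ true → p j ≡ true → rank p i ≡ rank p j → i ≡ j
  rank-injective p zero    zero    _  _  _  = refl
  rank-injective p zero    (suc j) pi _  eq rewrite pi = contradiction eq λ ()
  rank-injective p (suc i) zero    _  pj eq rewrite pj = contradiction eq λ ()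
  rank-injective p (suc i) (suc j) pi pj eq =
    cong suc (rank-injective (p ∘ suc) i j pi pj (ℕ.+-cancelˡ-≡ (χ (p zero)) _ _ eq))

  quotient-<⇒< : ∀ d {r r' q q'} → r < d → q < q' → r ℕ.+ d ℕ.* q < r' ℕ.+ d ℕ.* q'
  quotient-<⇒< d {r} {r'} {q} {q'} r<d q<q' = begin-strict
    r ℕ.+ d ℕ.* q     <⟨ ℕ.+-monoˡ-< (d ℕ.* q) r<d ⟩
    d ℕ.+ d ℕ.* q     ≡⟨ ℕ.*-suc d q ⟨
    d ℕ.* suc q       ≤⟨ ℕ.*-monoʳ-≤ d q<q' ⟩
    d ℕ.* q'          ≤⟨ ℕ.m≤n+m _ r' ⟩
    r' ℕ.+ d ℕ.* q'   ∎
    where open ℕ.≤-Reasoning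

  quotient-remainder-unique : ∀ d {r r' q q'} → r < d → r' < d → r ℕ.+ d ℕ.* q ≡ r' ℕ.+ d ℕ.* q' → r ≡ r' × q ≡ q'
  quotient-remainder-unique d {r} {r'} {q} {q'} r<d r'<d eq with ℕ.<-cmp q q'
  ... | tri≈ _ refl _ = ℕ.+-cancelʳ-≡ (d ℕ.* q) r r' eq , refl
  ... | tri< q<q' _ _ = contradiction eq (ℕ.<⇒≢ (quotient-<⇒< d r<d q<q'))
  ... | tri> _ _ q'<q = contradiction (sym eq) (ℕ.<⇒≢ (quotient-<⇒< d r'<d q'<q))

  sumℤ-minus : ∀ {n} (f g : Fin n → ℤ) → sumℤ (λ i → f i - g i) ≡ sumℤ f - sumℤ g
  sumℤ-minus {zero}  f g = refl
  sumℤ-minus {suc n} f g = trans (cong (λ w → f zero - g zero + w) (sumℤ-minus (f ∘ suc) (g ∘ suc)))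
    (regroup (f zero) (g zero) _ _)
    where
    regroup : ∀ a b c d → a - b + (c - d) ≡ a + c - (b + d)
    regroup = solve-∀

  ∣-sumℤ : ∀ {n d} (f : Fin n → ℤ) → (∀ i → d ∣ f i) → d ∣ sumℤ f
  ∣-sumℤ {zero}  f d∣f = divides 0ℤ refl
  ∣-sumℤ {suc n} f d∣f = ∣m∣n⇒∣m+n (d∣f zero) (∣-sumℤ (f ∘ suc) (d∣f ∘ suc))

  ∣-sumℤ-rest : ∀ {n d} (f : Fin (suc n) → ℤ) i → (∀ j → j ≢ i → d ∣ f j) → d ∣ sumℤ f → d ∣ f i
  ∣-sumℤ-rest f i d∣f d∣Σ = ∣m+n∣n⇒∣m (subst (_ ∣_) (sum-remove {i = i} f) d∣Σ)
    (∣-sumℤ _ (λ j → d∣f (punchIn i j) (punchInᵢ≢i i j)))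

  funToFin-cong : ∀ {m n} {f g : Fin m → Fin n} → (∀ i → f i ≡ g i) → funToFin f ≡ funToFin g
  funToFin-cong {zero}  f≡g = refl
  funToFin-cong {suc m} f≡g = cong₂ combine (f≡g zero) (funToFin-cong (f≡g ∘ suc))

  finToFun-injective : ∀ {m n} (i j : Fin (n ℕ.^ m)) → (∀ x → finToFun {n} {m} i x ≡ finToFun {n} {m} j x) → i ≡ j
  finToFun-injective {m} {n} i j eq =
    trans (sym (Fin.funToFin-finToFin {m} {n} i)) (trans (funToFin-cong {m} {n} eq) (Fin.funToFin-finToFin {m} {n} j))

  remQuot-injective : ∀ {m} k (i j : Fin (m ℕ.* k)) → remQuot {m} k i ≡ remQuot k j → i ≡ j
  remQuot-injective {m} k i j eq =
    trans (sym (Fin.combine-remQuot {m} k i)) (trans (cong (λ (a , b) → combine a b) eq) (Fin.combine-remQuot {m} k j))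

  -- There is one plane for each set `T j`, and `H σ` is the family of sets to be own for words of
  -- type `σ`. Each set is own for `N` types, so with `ℓ` levels a plane has `N ℓ` nonzero tags; the
  -- last hypothesis makes them fit below the modulus.
  module Construction
    {n k K' R ℓ N : ℕ} (g : ℕ)
    (T : Fin (suc K') → Subset n) (|T| : ∀ j → ∣ T j ∣ ≡ suc k)
    (T-injective : ∀ {i j} → T i ≡ T j → i ≡ j)
    (T-surjective : ∀ A → ∣ A ∣ ≡ suc k → ∃[ j ] A ≡ T j)
    (H : Fin R → Subset n → Bool)
    (H-regular : ∀ A → ∣ A ∣ ≡ suc k → count (λ σ → H σ A) ≡ N)
    (H-nonempty : ∀ σ → ∃[ j ] H σ (T j) ≡ true)
    (Nℓ≤ : N ℕ.* ℓ ≤ (2 ℕ.^ n) ! ℕ.* g)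
    where

    -- Modulo p all integers d with 0 < |d| < 2^n are units, as they divide p − 1.
    K p : ℕ
    K = suc K'
    p = suc ((2 ℕ.^ n) ! ℕ.* g)

    open Mod (+ p)

    α : Fin n → ℤ
    α = powers n

    separated : Separated α
    separated i j i≢j = regular g (∣factorial
      (ℕ.^-monoʳ-< 2 (s≤s (s≤s z≤n)) (toℕ<n i)) (ℕ.^-monoʳ-< 2 (s≤s (s≤s z≤n)) (toℕ<n j))
      (λ eq → i≢j (toℕ-injective (2^-injective eq))))
      where
      2^-injective : ∀ {a b} → 2 ℕ.^ a ≡ 2 ℕ.^ b → a ≡ b
      2^-injective {a} {b} eq with ℕ.<-cmp a b
      ... | tri≈ _ a≡b _ = a≡b
      ... | tri< a<b _ _ = contradiction eq (ℕ.<⇒≢ (ℕ.^-monoʳ-< 2 (s≤s (s≤s z≤n)) a<b))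
      ... | tri> _ _ b<a = contradiction (sym eq) (ℕ.<⇒≢ (ℕ.^-monoʳ-< 2 (s≤s (s≤s z≤n)) b<a))

    total : Subset n → ℤ
    total = subsetSum α

    total-regular : ∀ A B → A ≢ B → Regular (total A - total B)
    total-regular A B A≢B = subst₂ (λ a b → Regular (a - b)) (sym (subsetSum-powers n A)) (sym (subsetSum-powers n B))
      (regular g (∣factorial (binary<2^n A) (binary<2^n B) (A≢B ∘ binary-injective A B)))

    -- `level` is the parameter common to all planes. `free` holds the leading coefficients of all
    -- planes but the first, and `coeffs` the coefficients below the two highest degrees.
    record Message : Set where
      constructor message
      field
        type   : Fin R
        level  : Fin ℓ
        free   : Fin K' → Fin p
        coeffs : Fin K → Fin k → Fin p

    open Message

    record _≈_ (m m' : Message) : Set where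
      constructor equal
      field
        type≡   : type m ≡ type m'
        level≡  : level m ≡ level m'
        free≡   : ∀ j → free m j ≡ free m' j
        coeffs≡ : ∀ j i → coeffs m j i ≡ coeffs m' j i

    -- The first plane is adjusted so that all leading coefficients add up to `level`. This relation
    -- recovers the one leading coefficient about which `tag-congruence` says nothing.
    leading : Message → Fin K → ℤ
    leading m zero    = + toℕ (level m) - sumℤ (λ j → + toℕ (free m j))
    leading m (suc j) = + toℕ (free m j)

    -- Level and rank of the type are the digits of a number in base `ℓ`; the shift by one reserves
    -- zero for types that do not own `T j`.
    tag : Message → Fin K → ℕ
    tag m j = if H (type m) (T j)
      then suc (toℕ (level m) ℕ.+ ℓ ℕ.* rank (λ σ → H σ (T j)) (type m))
      else 0

    -- Chosen so that, on the points of T j, the polynomial of plane j coincides with one of degree k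
    -- whose x^k-coefficient is the tag.
    next : Message → Fin K → ℤ
    next m j = + tag m j - leading m j * total (T j)

    rest : Message → Fin K → Vec ℤ k
    rest m j = tabulate (λ i → + toℕ (coeffs m j i))

    value : Message → Fin K → ℤ → ℤ
    value m j = eval (leading m j) (next m j ∷ rest m j)

    residue : Message → Fin n → Fin K → Fin p
    residue m i j = fromℕ< (n%ℕd<d (value m j (α i)) p)

    symbol : Message → Fin n → Fin (p ℕ.^ K)
    symbol m i = funToFin (residue m i)

    symbol-congruent : ∀ m m' i → symbol m i ≡ symbol m' i → ∀ j → + p ∣ value m j (α i) - value m' j (α i)
    symbol-congruent m m' i eq j = %ℕ-congruent p (value m j (α i)) (value m' j (α i)) (begin
      value m j (α i) %ℕ p                               ≡⟨ toℕ-fromℕ< (n%ℕd<d (value m j (α i)) p) ⟨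
      toℕ (residue m i j)                                ≡⟨ cong toℕ (finToFun-funToFin (residue m i) j) ⟨
      toℕ (finToFun (symbol m i) j)                      ≡⟨ cong (λ s → toℕ (finToFun s j)) eq ⟩
      toℕ (finToFun (symbol m' i) j)                     ≡⟨ cong toℕ (finToFun-funToFin (residue m' i) j) ⟩
      toℕ (residue m' i j)                               ≡⟨ toℕ-fromℕ< (n%ℕd<d (value m' j (α i)) p) ⟩
      value m' j (α i) %ℕ p                              ∎)
      where open ≡-Reasoning

    tag<p : ∀ m j → tag m j < p
    tag<p m j with H (type m) (T j) in h
    ... | false = s≤s z≤n
    ... | true  = s≤s (begin-strict
      toℕ (level m) ℕ.+ ℓ ℕ.* r     <⟨ ℕ.+-monoˡ-< (ℓ ℕ.* r) (toℕ<n (level m)) ⟩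
      ℓ ℕ.+ ℓ ℕ.* r                 ≡⟨ ℕ.*-suc ℓ r ⟨
      ℓ ℕ.* suc r                   ≤⟨ ℕ.*-monoʳ-≤ ℓ (rank<count (λ σ → H σ (T j)) (type m) h) ⟩
      ℓ ℕ.* count (λ σ → H σ (T j)) ≡⟨ cong (ℓ ℕ.*_) (H-regular (T j) (|T| j)) ⟩
      ℓ ℕ.* N                       ≡⟨ ℕ.*-comm ℓ N ⟩
      N ℕ.* ℓ                       ≤⟨ Nℓ≤ ⟩
      (2 ℕ.^ n) ! ℕ.* g             ∎)
      where
      open ℕ.≤-Reasoning
      r = rank (λ σ → H σ (T j)) (type m)

    -- The first tag is nonzero, hence so is the second. Comparing digits gives the level and the
    -- rank, and the rank determines the type.
    tag-reveals : ∀ m m' j → H (type m) (T j) ≡ true → tag m j ≡ tag m' j →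
                  type m ≡ type m' × level m ≡ level m'
    tag-reveals m m' j h eq with H (type m) (T j) in h₁ | H (type m') (T j) in h₂
    ... | true | true =
      let level≡ , rank≡ = quotient-remainder-unique ℓ (toℕ<n (level m)) (toℕ<n (level m')) (ℕ.suc-injective eq)
      in rank-injective (λ σ → H σ (T j)) (type m) (type m') h₁ h₂ rank≡ , toℕ-injective level≡

    tag-cong : ∀ m m' j → type m ≡ type m' → level m ≡ level m' → tag m j ≡ tag m' j
    tag-cong m m' j refl refl = refl

    module _ (m m' : Message) where

      AgreeAt : Fin n → Set
      AgreeAt i = symbol m i ≡ symbol m' i

      ΔL ΔN : Fin K → ℤ
      ΔL j = leading m j - leading m' j
      ΔN j = next m j - next m' j
      ΔR : Fin K → Vec ℤ k
      ΔR j = zipWith _-_ (rest m j) (rest m' j)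

      roots : ∀ A → (∀ i → i ∈ A → AgreeAt i) → ∀ j → Roots α A (ΔL j) (ΔN j ∷ ΔR j)
      roots A agree j i i∈A = subst (+ p ∣_)
        (eval-minus (leading m j) (leading m' j) (next m j ∷ rest m j) (next m' j ∷ rest m' j) (α i))
        (symbol-congruent m m' i (agree i i∈A) j)

      -- Vieta for the difference of the two polynomials of plane `j`, which vanishes on `A`. By the
      -- choice of `next`, its second coefficient is the difference of the tags minus
      -- `ΔL j * total (T j)`.
      tag-congruence : ∀ A → ∣ A ∣ ≡ suc k → (∀ i → i ∈ A → AgreeAt i) → ∀ j →
                       + p ∣ (+ tag m j - + tag m' j) + (total A - total (T j)) * ΔL j
      tag-congruence A |A| agree j = subst (+ p ∣_)
        (regroup (+ tag m j) (+ tag m' j) (leading m j) (leading m' j) (total A) (total (T j)))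
        (vieta α separated A |A| (ΔL j) (ΔN j) (ΔR j) (roots A agree j))
        where
        regroup : ∀ a a' l l' s t → (a - l * t) - (a' - l' * t) + (l - l') * s ≡ (a - a') + (s - t) * (l - l')
        regroup = solve-∀

      coeffs-equal : ∀ j → All (+ p ∣_) (ΔR j) → ∀ i → coeffs m j i ≡ coeffs m' j i
      coeffs-equal j all i = toℕ-injective (residues-equal (toℕ<n (coeffs m j i)) (toℕ<n (coeffs m' j i))
        (subst (+ p ∣_) (trans (lookup-zipWith _-_ i (rest m j) (rest m' j)) (cong₂ _-_ (lookup∘tabulate _ i) (lookup∘tabulate _ i)))
          (lookup⁺ all i)))

      leading⇒≈ : type m ≡ type m' → level m ≡ level m' → (∀ j → + p ∣ ΔL j) →
                  (∀ j → All (+ p ∣_) (ΔR j)) → m ≈ m'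
      leading⇒≈ type≡ level≡ p∣ΔL p∣ΔR = equal type≡ level≡
        (λ j → toℕ-injective (residues-equal (toℕ<n (free m j)) (toℕ<n (free m' j)) (p∣ΔL (suc j))))
        (λ j → coeffs-equal j (p∣ΔR j))

      ΣΔL : sumℤ ΔL ≡ + toℕ (level m) - + toℕ (level m')
      ΣΔL = trans (sumℤ-minus (leading m) (leading m')) (cancel (+ toℕ (level m)) (Σfree m) (+ toℕ (level m')) (Σfree m'))
        where
        Σfree : Message → ℤ
        Σfree m = sumℤ (λ j → + toℕ (free m j))
        cancel : ∀ a s b t → (a - s + s) - (b - t + t) ≡ a - b
        cancel = solve-∀

      -- On the plane of `A` the factor `total A - total (T j)` is zero, so the tags agree and
      -- reveal type and level. Then the tags agree on every plane, and elsewhere the factor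
      -- cancels, so the leading coefficients agree; `ΣΔL` settles the plane of `A`. The lower
      -- coefficients follow by `vanishing`.
      agree-own⇒≈ : ∀ A → ∣ A ∣ ≡ suc k → (∀ i → i ∈ A → AgreeAt i) → H (type m) A ≡ true → m ≈ m'
      agree-own⇒≈ A |A| agree own with T-surjective A |A|
      ... | j₀ , refl = leading⇒≈ type≡ level≡ p∣ΔL (λ j → All.tail (vanishing α separated A |A| (ΔL j) (ΔN j ∷ ΔR j) (p∣ΔL j) (roots A agree j)))
        where
        tag≡ : tag m j₀ ≡ tag m' j₀
        tag≡ = residues-equal (tag<p m j₀) (tag<p m' j₀)
          (subst (+ p ∣_) (cancel _ (total A) (ΔL j₀)) (tag-congruence A |A| agree j₀))
          where
          cancel : ∀ a s l → a + (s - s) * l ≡ a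
          cancel = solve-∀
        type≡ = proj₁ (tag-reveals m m' j₀ own tag≡)
        level≡ = proj₂ (tag-reveals m m' j₀ own tag≡)
        p∣ΔL-other : ∀ j → j ≢ j₀ → + p ∣ ΔL j
        p∣ΔL-other j j≢j₀ = total-regular A (T j) (j≢j₀ ∘ sym ∘ T-injective) (ΔL j)
          (∣m+n∣m⇒∣n (tag-congruence A |A| agree j)
            (divides 0ℤ (ℤ.i≡j⇒i-j≡0 (cong +_ (tag-cong m m' j type≡ level≡)))))
        p∣ΔL : ∀ j → + p ∣ ΔL j
        p∣ΔL j with j Fin.≟ j₀
        ... | no  j≢j₀ = p∣ΔL-other j j≢j₀
        ... | yes refl = ∣-sumℤ-rest ΔL j₀ p∣ΔL-other
          (divides 0ℤ (trans ΣΔL (ℤ.i≡j⇒i-j≡0 (cong (λ l → + toℕ l) level≡))))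

      -- A difference of degree at most `suc k` with `suc (suc k)` roots vanishes. A plane whose set
      -- is own for the type then has equal nonzero tags.
      agree-large⇒≈ : ∀ A → ∣ A ∣ ≡ suc (suc k) → (∀ i → i ∈ A → AgreeAt i) → m ≈ m'
      agree-large⇒≈ A |A| agree = leading⇒≈ type≡ level≡ p∣ΔL (λ j → All.tail (All.tail (all j)))
        where
        all : ∀ j → All (+ p ∣_) (ΔL j ∷ ΔN j ∷ ΔR j)
        -- An additional leading coefficient zero makes the formal degree match the number of
        -- points.
        all j = vanishing α separated A |A| 0ℤ (ΔL j ∷ ΔN j ∷ ΔR j) (divides 0ℤ refl)
          (λ i i∈A → subst (λ b → + p ∣ eval b (ΔN j ∷ ΔR j) (α i)) (sym (ℤ.+-identityˡ (ΔL j))) (roots A agree j i i∈A))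
        p∣ΔL : ∀ j → + p ∣ ΔL j
        p∣ΔL j = All.head (all j)
        j₀ = proj₁ (H-nonempty (type m))
        tag≡ : tag m j₀ ≡ tag m' j₀
        tag≡ = residues-equal (tag<p m j₀) (tag<p m' j₀) (subst (+ p ∣_)
          (regroup (+ tag m j₀) (+ tag m' j₀) (leading m j₀) (leading m' j₀) (total (T j₀)))
          (∣m∣n⇒∣m+n (All.head (All.tail (all j₀))) (∣m⇒∣m*n (total (T j₀)) (p∣ΔL j₀))))
          where
          regroup : ∀ a a' l l' t → (a - l * t) - (a' - l' * t) + (l - l') * t ≡ a - a'
          regroup = solve-∀
        revealed = tag-reveals m m' j₀ (proj₂ (H-nonempty (type m))) tag≡
        type≡ = proj₁ revealed
        level≡ = proj₂ revealed

    size₁ size₂ size : ℕ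
    size₂ = p ℕ.^ K' ℕ.* (p ℕ.^ k) ℕ.^ K
    size₁ = ℓ ℕ.* size₂
    size  = R ℕ.* size₁

    decode : Fin size → Message
    decode w =
      let σ , w₁ = remQuot {R} size₁ w
          l , w₂ = remQuot {ℓ} size₂ w₁
          a , b  = remQuot {p ℕ.^ K'} ((p ℕ.^ k) ℕ.^ K) w₂
      in message σ l (finToFun {p} {K'} a) (λ j → finToFun {p} {k} (finToFun {p ℕ.^ k} {K} b j))

    decode-injective : ∀ w w' → decode w ≈ decode w' → w ≡ w'
    decode-injective w w' (equal σ≡ l≡ a≡ b≡) =
      remQuot-injective {R} size₁ w w' (cong₂ _,_ σ≡
        (remQuot-injective {ℓ} size₂ (proj₂ (remQuot {R} size₁ w)) (proj₂ (remQuot {R} size₁ w')) (cong₂ _,_ l≡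
          (remQuot-injective {p ℕ.^ K'} ((p ℕ.^ k) ℕ.^ K) (tailOf w) (tailOf w') (cong₂ _,_
            (finToFun-injective {K'} {p} _ _ a≡)
            (finToFun-injective {K} {p ℕ.^ k} _ _ (λ j → finToFun-injective {k} {p} _ _ (b≡ j))))))))
      where
      tailOf : Fin size → Fin size₂
      tailOf w = proj₂ (remQuot {ℓ} size₂ (proj₂ (remQuot {R} size₁ w)))

    module _ {q} (p^K≤q : p ℕ.^ K ≤ q) where

      codeword : Fin size → Word q n
      codeword w i = inject≤ (symbol (decode w) i) p^K≤q

      agreement : Fin size → Fin size → Fin n → Bool
      agreement w w' i = does (codeword w' i Fin.≟ codeword w i)

      agreement⇒ : ∀ w w' i → agreement w w' i ≡ true → AgreeAt (decode w) (decode w') i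
      agreement⇒ w w' i e = sym (inject≤-injective p^K≤q p^K≤q _ _ (witness (codeword w' i Fin.≟ codeword w i) e))

      module _ {w w' : Fin size} (w≢w' : w ≢ w') where

        agreement-small : count (agreement w w') ≤ suc k
        agreement-small = ℕ.≮⇒≥ λ large →
          let A , A⊆ , |A| = subset-of-size (agreement w w') (suc (suc k)) large
          in w≢w' (decode-injective w w' (agree-large⇒≈ (decode w) (decode w') (tabulate A) (trans (∣tabulate∣ A) |A|)
               (λ i i∈A → agreement⇒ w w' i (A⊆ i (∈ˢ-tabulate⁻ A i∈A)))))

        agreement-not-own : ∀ A → ∣ A ∣ ≡ suc k → (∀ i → i ∈ A → codeword w' i ≡ codeword w i) →
                            H (type (decode w)) A ≡ false
        agreement-not-own A |A| agree with H (type (decode w)) A in h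
        ... | false = refl
        ... | true  = contradiction (decode-injective w w' (agree-own⇒≈ (decode w) (decode w') A |A|
          (λ i i∈A → sym (inject≤-injective p^K≤q p^K≤q _ _ (agree i i∈A))) h)) w≢w'

      codeword-injective : ∀ {w w'} → codeword w ≡ codeword w' → w ≡ w'
      codeword-injective {w} {w'} eq =
        let j , own = H-nonempty (type (decode w))
        in decode-injective w w' (agree-own⇒≈ (decode w) (decode w') (T j) (|T| j)
             (λ i _ → inject≤-injective p^K≤q p^K≤q _ _ (cong (λ x → x i) eq)) own)

-- Frameproofness and size of the code.

module Codes where

  open Counting
  open Subsets
  open AlgebraicCode
  open import Defs
  open import Data.Bool.Base using (Bool; true; false; not)
  import Data.Bool.Properties as Bool
  open import Data.Fin.Base using (Fin; suc; fromℕ<)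
  open import Data.Fin.Properties as Fin using (any?)
  open import Data.Fin.Subset using (Subset; ∣_∣)
  open import Data.List.Base as List using (List; _∷_; length; filter)
  open import Data.List.Properties using (length-tabulate)
  open import Data.List.Membership.Propositional using () renaming (_∈_ to _∈ᴸ_)
  open import Data.List.Membership.Propositional.Properties using (∈-lookup; ∈-filter⁺; ∈-tabulate⁻)
  import Data.List.Membership.DecPropositional as DecMembership
  open import Data.List.Relation.Unary.Any using (index)
  open import Data.List.Relation.Unary.Any.Properties using (lookup-index)
  open import Data.List.Relation.Unary.Unique.Propositional using (Unique)
  import Data.List.Relation.Unary.Unique.Propositional.Properties as Unique
  open import Data.Nat.Base
  open import Data.Nat.Properties
  open import Data.Nat.Tactic.RingSolver using (solve-∀)
  open import Data.Product.Base as Product using (Σ; ∃; ∃-syntax; _×_; _,_; proj₁; proj₂)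
  open import Data.Vec.Base using (lookup; tabulate)
  open import Data.Vec.Properties using (lookup∘tabulate; []=⇒lookup)
  open import Function.Base using (_∘_; id)
  open import Relation.Binary.PropositionalEquality
  open import Relation.Nullary using (¬_; yes; no; does; contradiction)
  open import Algebra.Properties.Semiring.Sum +-*-semiring using (sum-cong-≗)

  record Enumerates {a} {A : Set a} (xs : List A) (k : ℕ) : Set a where
    field
      entry      : Fin (suc k) → A
      length≡    : length xs ≡ suc k
      entry∈     : ∀ i → entry i ∈ᴸ xs
      injective  : Unique xs → ∀ {i j} → entry i ≡ entry j → i ≡ j
      surjective : ∀ {x} → x ∈ᴸ xs → ∃[ i ] x ≡ entry i

  enumerate : ∀ {a} {A : Set a} (xs : List A) → 0 < length xs → ∃ (Enumerates xs)
  enumerate (x ∷ xs) _ = length xs , record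
    { entry      = List.lookup (x ∷ xs)
    ; length≡    = refl
    ; entry∈     = ∈-lookup
    ; injective  = λ xs! → lookup-injective xs!
    ; surjective = λ x∈ → index x∈ , lookup-index x∈
    }

  -- `R` counts types and `b * h` levels. For `p = 1 + b (M W) h` the right side is
  -- `L (p - 1) p ^ (r + k (r + 1))`, which is asymptotic to `L q ^ (k + 1)` for `q = p ^ (r + 1)`.
  message-count : ∀ R L W M b h p r k → R ≡ L * W →
    R * (b * h * (p ^ r * (p ^ k) ^ suc r)) * M ≡ L * (b * (M * W) * h * p ^ (r + k * suc r))
  message-count R L W M b h p r k R≡ = begin
    R * (b * h * (p ^ r * (p ^ k) ^ suc r)) * M
      ≡⟨ cong₂ (λ x y → x * (b * h * y) * M) R≡ (trans (cong (p ^ r *_) (^-*-assoc p k (suc r))) (sym (^-distribˡ-+-* p r (k * suc r)))) ⟩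
    L * W * (b * h * p ^ (r + k * suc r)) * M
      ≡⟨ regroup L W b h (p ^ (r + k * suc r)) M ⟩
    L * (b * (M * W) * h * p ^ (r + k * suc r)) ∎
    where
    open ≡-Reasoning
    regroup : ∀ L W b h P M → L * W * (b * h * P) * M ≡ L * (b * (M * W) * h * P)
    regroup = solve-∀

  module LowerBound {n} (c s u l k : ℕ) (s+u≡c : s + u ≡ c) (l≤c : l ≤ c) (sn≡ck+l : s * n ≡ c * k + l)
    (F : List (Subset n)) (F! : Unique F) (F-good : IsGoodFamily n (suc k) l (s + 1) (u + 1) F) where

    open DecMembership (_≟ˢ_ {n}) using (_∈?_)

    subsets : List (Subset n)
    subsets = subsetsOfSize n (suc k)

    outsideF : Subset n → Bool
    outsideF A = not (does (A ∈? F))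

    outsideF-false : ∀ {A} → outsideF A ≡ false → A ∈ᴸ F
    outsideF-false {A} e with yes A∈F ← A ∈? F = A∈F

    M : ℕ
    M = count (outsideF ∘ List.lookup subsets)

    no-balanced-in-F : (A : Fin l → Subset n) → (∀ i → A i ∈ᴸ F) → ¬ Balanced s u (lookup ∘ A)
    no-balanced-in-F A A∈F bal = proj₂ F-good A A∈F (Balanced⇒KDisjoint A bal , Balanced⇒KCovering A bal)

    -- `Balanced` is a condition at each point, so it survives composition with `π`, and the
    -- relabelled sequence would be a forbidden one inside `F`.
    relabelled-not-in-F : (φ : Subset n → Subset n) (π : Fin n → Fin n) →
      (∀ A x → lookup (φ A) x ≡ lookup A (π x)) →
      (A : Fin l → Subset n) → Balanced s u (lookup ∘ A) → ¬ (∀ i → φ (A i) ∈ᴸ F)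
    relabelled-not-in-F φ π φ-π A bal φA∈F = no-balanced-in-F (φ ∘ A) φA∈F
      (Balanced-cong (λ j x → sym (φ-π (A j) x)) (bal ∘ π))

    -- Otherwise the sequence of `balanced-exists` would be relabelled into `F`. The identity gives
    -- `M>0`, and permutations give every type an own set.
    some-outside : (φ : Subset n → Subset n) (π : Fin n → Fin n) →
      (∀ A x → lookup (φ A) x ≡ lookup A (π x)) → ¬ (∀ A → ∣ A ∣ ≡ suc k → outsideF (φ A) ≡ false)
    some-outside φ π φ-π none =
      let A , |A| , bal = balanced-exists n s k l u s+u≡c l≤c sn≡ck+l
      in relabelled-not-in-F φ π φ-π A bal (λ i → outsideF-false (none (A i) (|A| i)))

    M>0 : 0 < M
    M>0 = ≰⇒> λ M≤0 → some-outside id id (λ _ _ → refl) λ A |A| →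
      let A∈ = subst (λ t → A ∈ᴸ subsetsOfSize n t) |A| (∈-subsetsOfSize⁺ A)
      in χ-injective (n≤0⇒n≡0 (≤-trans (≤-reflexive (cong (χ ∘ outsideF) (lookup-index A∈)))
           (≤-trans (≤sum (χ ∘ outsideF ∘ List.lookup subsets) (index A∈)) M≤0)))

    subsets>0 : 0 < length subsets
    subsets>0 = ≤-trans M>0 (≤-trans (sum-mono (λ i → χ≤1 (outsideF (List.lookup subsets i))))
      (≤-reflexive (trans (sum-const (length subsets) 1) (*-identityʳ (length subsets)))))

    M+|F|≤ : M + length F ≤ length subsets
    M+|F|≤ = begin
      M + length F                              ≤⟨ +-monoʳ-≤ M (Unique-⊆⇒length≤ F! F⊆) ⟩
      M + length (filter (_∈? F) subsets)       ≡⟨ cong (M +_) (length-filter (_∈? F) subsets) ⟩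
      M + count inF                             ≡⟨ +-comm M _ ⟩
      count inF + M                             ≡⟨ count-not inF ⟩
      length subsets                            ∎
      where
      open ≤-Reasoning
      inF : Fin (length subsets) → Bool
      inF i = does (List.lookup subsets i ∈? F)
      F⊆ : ∀ {A} → A ∈ᴸ F → A ∈ᴸ filter (_∈? F) subsets
      F⊆ {A} A∈F = ∈-filter⁺ (_∈? F) (subst (λ t → A ∈ᴸ subsetsOfSize n t) (proj₁ F-good A∈F) (∈-subsetsOfSize⁺ A)) A∈F

    -- Using all permutations makes every set of size `suc k` own for equally many types.
    H : Fin (n !) → Subset n → Bool
    H σ A = outsideF (permute n σ A)

    N : ℕ
    N = M * stabilizerSize n (suc k)

    H-regular : ∀ A → ∣ A ∣ ≡ suc k → count (λ σ → H σ A) ≡ N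
    H-regular A |A| = count-orbit n (suc k) outsideF A |A|

    n!≡ : n ! ≡ length subsets * stabilizerSize n (suc k)
    n!≡ = trans (sym (trans (sum-const (n !) 1) (*-identityʳ (n !))))
      (trans (count-orbit n (suc k) (λ _ → true) (List.lookup subsets (fromℕ< subsets>0))
                (∈-subsetsOfSize⁻ n (suc k) (∈-lookup (fromℕ< subsets>0))))
             (cong (_* stabilizerSize n (suc k)) (trans (sum-const (length subsets) 1) (*-identityʳ (length subsets)))))

    module WithEnumeration {K'} (enumeration : Enumerates subsets K') where

      open Enumerates enumeration renaming (entry to T)

      |T| : ∀ j → ∣ T j ∣ ≡ suc k
      |T| j = ∈-subsetsOfSize⁻ n (suc k) (entry∈ j)

      T-injective : ∀ {i j} → T i ≡ T j → i ≡ j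
      T-injective = injective (subsetsOfSize-! n (suc k))

      T-surjective : ∀ A → ∣ A ∣ ≡ suc k → ∃[ j ] A ≡ T j
      T-surjective A |A| = surjective (subst (λ t → A ∈ᴸ subsetsOfSize n t) |A| (∈-subsetsOfSize⁺ A))

      H-nonempty : ∀ σ → ∃[ j ] H σ (T j) ≡ true
      H-nonempty σ with any? (λ j → H σ (T j) Bool.≟ true)
      ... | yes found = found
      ... | no  none  = contradiction
        (λ A |A| → let j , A≡T = T-surjective A |A| in
          trans (cong (H σ) A≡T) (Bool.¬-not λ own → none (j , own)))
        (some-outside (permute n σ) (source n σ) (lookup-permute n σ))

      module _ (g ℓ : ℕ) (Nℓ≤ : N * ℓ ≤ (2 ^ n) ! * g) where

        open Construction g T |T| T-injective T-surjective H H-regular H-nonempty Nℓ≤ public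

        module _ {q} (p^K≤q : p ^ K ≤ q) where

          code : Code q n
          code = List.tabulate (codeword p^K≤q)

          code-! : Unique code
          code-! = Unique.tabulate⁺ (codeword-injective p^K≤q)

          -- If every coordinate had at least `s` agreements, the agreement sets would contain a
          -- balanced sequence of sets of size `suc k`. None of them is own for the type of `x`, so
          -- `σ` takes them all into `F`.
          code-frameproof : IsFrameproof c s code
          code-frameproof x x∈ xs xs∈ x≢xs with any? (λ i → agreeCount xs x i <? s)
          ... | yes found = found
          ... | no  none  = contradiction (λ i → outsideF-false (seq-own i))
            (relabelled-not-in-F (permute n σ) (source n σ) (lookup-permute n σ) (tabulate ∘ E ∘ e)
              (Balanced-cong (λ j y → sym (lookup∘tabulate (E (e j)) y)) bal))
            where
            w : Fin size
            w = proj₁ (∈-tabulate⁻ x∈)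
            x≡ : x ≡ codeword p^K≤q w
            x≡ = proj₂ (∈-tabulate⁻ x∈)
            w' : Fin c → Fin size
            w' j = proj₁ (∈-tabulate⁻ (xs∈ j))
            xs≡ : ∀ j → xs j ≡ codeword p^K≤q (w' j)
            xs≡ j = proj₂ (∈-tabulate⁻ (xs∈ j))
            w≢w' : ∀ j → w ≢ w' j
            w≢w' j eq = x≢xs j (trans x≡ (trans (cong (codeword p^K≤q) eq) (sym (xs≡ j))))
            σ : Fin (n !)
            σ = Message.type (decode w)
            E : Fin c → Fin n → Bool
            E j = agreement p^K≤q w (w' j)
            s≤E : ∀ i → s ≤ degree E i
            s≤E i = ≤-trans (≮⇒≥ (λ few → none (i , few))) (≤-reflexive (trans
              (length-filter-tabulate (λ j → xs j i Fin.≟ x i) id)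
              (sum-cong-≗ λ j → cong χ (cong₂ (λ y z → does (y i Fin.≟ z i)) (xs≡ j) x≡))))
            sub = balanced-subsequence s k l u s+u≡c sn≡ck+l E (λ j → agreement-small p^K≤q (w≢w' j)) s≤E
            e = proj₁ sub
            bal = proj₂ (proj₂ sub)
            seq-own : ∀ i → H σ (tabulate (E (e i))) ≡ false
            seq-own i = agreement-not-own p^K≤q (w≢w' (e i)) (tabulate (E (e i)))
              (trans (∣tabulate∣ (E (e i))) (proj₁ (proj₂ sub) i))
              (λ y y∈ → witness (codeword p^K≤q (w' (e i)) y Fin.≟ codeword p^K≤q w y)
                (trans (sym (lookup∘tabulate (E (e i)) y)) ([]=⇒lookup y∈)))

      codes : ∀ h q → suc ((2 ^ n) ! * N * h) ^ suc K' ≤ q →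
        Σ (Code q n) λ C → Unique C × IsFrameproof c s C ×
          length C * M ≡ length subsets * ((2 ^ n) ! * N * h * suc ((2 ^ n) ! * N * h) ^ (K' + k * suc K'))
      codes h q p^K≤q = code g ℓ Nℓ≤ p^K≤q' , code-! g ℓ Nℓ≤ p^K≤q' , code-frameproof g ℓ Nℓ≤ p^K≤q' ,
        trans (cong (_* M) (length-tabulate (codeword g ℓ Nℓ≤ p^K≤q')))
          (trans (message-count (n !) (length subsets) (stabilizerSize n (suc k)) M ((2 ^ n) !) h (suc ((2 ^ n) ! * g)) K' k n!≡)
            (cong (λ x → length subsets * ((2 ^ n) ! * N * h * suc x ^ (K' + k * suc K'))) (sym assoc)))
        where
        -- These values make `N * ℓ` equal to `(2 ^ n) ! * g`, so the available tags fill all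
        -- residues and the size is optimal to leading order.
        g ℓ : ℕ
        g = N * h
        ℓ = (2 ^ n) ! * h
        assoc : (2 ^ n) ! * N * h ≡ (2 ^ n) ! * g
        assoc = *-assoc ((2 ^ n) !) N h
        p^K≤q' : suc ((2 ^ n) ! * g) ^ suc K' ≤ q
        p^K≤q' = subst (λ x → suc x ^ suc K' ≤ q) assoc p^K≤q
        Nℓ≤ : N * ℓ ≤ (2 ^ n) ! * g
        Nℓ≤ = ≤-reflexive (trans (sym (*-assoc N ((2 ^ n) !) h)) (trans (cong (_* h) (*-comm N ((2 ^ n) !))) assoc))

    N>0 : 0 < N
    N>0 = *-mono-≤ M>0 (*-mono-≤ (1≤n! (suc k)) (1≤n! (n ∸ suc k)))

    -- `D` is the step of the progression of moduli `1 + D h`, and `suc r` is the number of planes.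
    CodesOver : ℕ → ℕ → Set
    CodesOver D r = ∀ h q → suc (D * h) ^ suc r ≤ q → Σ (Code q n) λ C → Unique C × IsFrameproof c s C ×
      length C * M ≡ length subsets * (D * h * suc (D * h) ^ (r + k * suc r))

    codes-exist : ∃[ D ] ∃[ r ] 0 < D × CodesOver D r
    codes-exist = (2 ^ n) ! * N , proj₁ found , *-mono-≤ (1≤n! (2 ^ n)) N>0 , proj₂ found
      where
      found : ∃ (CodesOver ((2 ^ n) ! * N))
      found = Product.map₂ (λ E → WithEnumeration.codes E) (enumerate subsets subsets>0)

-- Asymptotic estimates in natural numbers.

module Asymptotics where

  open import Data.Nat.Base
  open import Data.Nat.Properties
  open import Data.Nat.Tactic.RingSolver using (solve-∀)
  open import Data.Product.Base using (∃-syntax; _×_; _,_)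
  open import Data.Sum.Base using (inj₁; inj₂)
  open import Relation.Binary.PropositionalEquality
  open import Relation.Nullary using (yes; no)

  -- Selects the modulus for a given alphabet size: when `q` grows by one, `h` advances by at most
  -- one.
  interval : (G : ℕ → ℕ) → (∀ h → G h < G (suc h)) → ∀ h₀ q → G h₀ ≤ q →
             ∃[ h ] h₀ ≤ h × G h ≤ q × q < G (suc h)
  interval G G< h₀ zero    G≤q = h₀ , ≤-refl , G≤q , ≤-trans (s≤s z≤n) (G< h₀)
  interval G G< h₀ (suc q) G≤q with G h₀ ≤? q
  ... | no  G≰q = h₀ , ≤-refl , G≤q , ≤-<-trans (≰⇒> G≰q) (G< h₀)
  ... | yes G≤q' with interval G G< h₀ q G≤q'
  ...   | h , h₀≤h , Gh≤q , q<G with suc q <? G (suc h)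
  ...     | yes sq<G = h , h₀≤h , m≤n⇒m≤1+n Gh≤q , sq<G
  ...     | no  sq≮G = suc h , m≤n⇒m≤1+n h₀≤h , ≮⇒≥ sq≮G , ≤-<-trans q<G (G< (suc h))

  -- Bernoulli's inequality (1 − e/x)^d ≥ 1 − d e/x for x = y + e, multiplied out.
  bernoulli : ∀ y e d → let x = y + e in x ^ d * x ≤ y ^ d * x + d * e * x ^ d
  bernoulli y e zero    = m≤m+n _ _
  bernoulli y e (suc d) = begin
    x * x ^ d * x                                  ≡⟨ *-assoc x (x ^ d) x ⟩
    x * (x ^ d * x)                                ≤⟨ *-monoʳ-≤ x (bernoulli y e d) ⟩
    x * (y ^ d * x + d * e * x ^ d)                ≡⟨ expand y e d (y ^ d) (x ^ d) ⟩
    y * y ^ d * x + (e * (y ^ d * x) + d * e * (x * x ^ d))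
                                                   ≤⟨ +-monoʳ-≤ (y * y ^ d * x) (+-monoˡ-≤ _ (*-monoʳ-≤ e (*-monoˡ-≤ x (^-monoˡ-≤ d (m≤m+n y e))))) ⟩
    y * y ^ d * x + (e * (x ^ d * x) + d * e * (x * x ^ d))
                                                   ≡⟨ cong (y * y ^ d * x +_) (collect e x d (x ^ d)) ⟩
    y * y ^ d * x + (e + d * e) * (x * x ^ d)      ∎
    where
    open ≤-Reasoning
    x = y + e
    expand : ∀ y e d Y X → (y + e) * (Y * (y + e) + d * e * X) ≡ y * Y * (y + e) + (e * (Y * (y + e)) + d * e * ((y + e) * X))
    expand = solve-∀
    collect : ∀ e x d X → e * (X * x) + d * e * (x * X) ≡ (e + d * e) * (x * X)
    collect = solve-∀

  0<^ : ∀ {m} k → 0 < m → 0 < m ^ k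
  0<^ {suc m} k _ = m^n>0 (suc m) k

  -- The conclusion is `C / M < f q / q ^ t + 1 / E` with denominators cleared. With `y = D h` and
  -- the next modulus `a`, one has `f q M ≥ C y ^ (d + 1)` and `q ^ t ≤ a ^ (d + 1)`, and Bernoulli
  -- compares the two powers.
  lower-asymptotics : ∀ (D r t d C M : ℕ) (f : ℕ → ℕ) → 0 < D → 0 < M → suc r * t ≡ suc d →
    (∀ q h → suc (D * h) ^ suc r ≤ q → C * (D * h * suc (D * h) ^ d) ≤ f q * M) →
    ∀ E → ∃[ Q ] (∀ q → Q ≤ q → E * (C * q ^ t) < E * (f q * M) + M * q ^ t)
  lower-asymptotics D r t d C M f 0<D 0<M rt≡ bound E = G h₀ , λ q Q≤q → close q Q≤q
    where
    e h₀ : ℕ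
    -- The distance from `D h` to the next modulus `1 + D (h + 1)`.
    e = suc D
    -- For `a > h₀` the loss `C (d + 1) e / a` is below `1 / E`.
    h₀ = E * C * (suc d * e)
    G : ℕ → ℕ
    G h = suc (D * h) ^ suc r
    G< : ∀ h → G h < G (suc h)
    G< h = ^-monoˡ-< (suc r) (s≤s (*-monoʳ-< D {{>-nonZero 0<D}} (n<1+n h)))
    close : ∀ q → G h₀ ≤ q → E * (C * q ^ t) < E * (f q * M) + M * q ^ t
    close q Q≤q with interval G G< h₀ q Q≤q
    ... | h , h₀≤h , Gh≤q , q<G = *-cancelʳ-< a _ _ (begin-strict
      E * (C * q ^ t) * a                                      ≡⟨ assoc₃ E C (q ^ t) a ⟩
      E * C * (q ^ t * a)                                      ≤⟨ *-monoʳ-≤ (E * C) main ⟩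
      E * C * (Y * a + suc d * e * q ^ t)                      ≡⟨ expand E C Y a (suc d * e) (q ^ t) ⟩
      E * (C * Y) * a + h₀ * q ^ t                             ≤⟨ +-monoˡ-≤ (h₀ * q ^ t) (*-monoˡ-≤ a (*-monoʳ-≤ E CY≤)) ⟩
      E * (f q * M) * a + h₀ * q ^ t                           <⟨ +-monoʳ-< (E * (f q * M) * a) (*-monoˡ-< (q ^ t) {{>-nonZero (0<^ t 0<q)}} h₀<a) ⟩
      E * (f q * M) * a + a * q ^ t                            ≤⟨ +-monoʳ-≤ (E * (f q * M) * a) (m≤n*m (a * q ^ t) M {{>-nonZero 0<M}}) ⟩
      E * (f q * M) * a + M * (a * q ^ t)                      ≡⟨ factor (E * (f q * M)) a M (q ^ t) ⟩
      (E * (f q * M) + M * q ^ t) * a                          ∎)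
      where
      open ≤-Reasoning
      y a Y : ℕ
      y = D * h
      a = y + e
      Y = y ^ suc d
      a≡ : a ≡ suc (D * suc h)
      a≡ = trans (+-suc y D) (cong suc (trans (+-comm y D) (sym (*-suc D h))))
      0<q : 0 < q
      0<q = ≤-trans (0<^ (suc r) (s≤s z≤n)) Gh≤q
      h₀<a : h₀ < a
      h₀<a = ≤-trans (s≤s (≤-trans h₀≤h (m≤n*m h D {{>-nonZero 0<D}}))) (≤-trans (s≤s (m≤m+n y D)) (≤-reflexive (sym (+-suc y D))))
      CY≤ : C * Y ≤ f q * M
      CY≤ = ≤-trans (*-monoʳ-≤ C (*-monoʳ-≤ y (^-monoˡ-≤ d (n≤1+n y)))) (bound q h Gh≤q)
      q^t≤ : q ^ t ≤ a ^ suc d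
      q^t≤ = begin
        q ^ t                               ≤⟨ ^-monoˡ-≤ t (<⇒≤ q<G) ⟩
        (suc (D * suc h) ^ suc r) ^ t       ≡⟨ ^-*-assoc (suc (D * suc h)) (suc r) t ⟩
        suc (D * suc h) ^ (suc r * t)       ≡⟨ cong₂ _^_ (sym a≡) rt≡ ⟩
        a ^ suc d                           ∎
      -- Bernoulli with `q ^ t` in place of `a ^ (d + 1)`. If `(d + 1) e ≥ a`, the last term alone
      -- suffices; otherwise `a - (d + 1) e` is a true difference and may multiply the bound on
      -- `q ^ t`.
      main : q ^ t * a ≤ Y * a + suc d * e * q ^ t
      main with ≤-total (suc d * e) a
      ... | inj₂ a≤de = ≤-trans (≤-reflexive (*-comm (q ^ t) a)) (≤-trans (*-monoˡ-≤ (q ^ t) a≤de) (m≤n+m _ (Y * a)))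
      ... | inj₁ de≤a = begin
        q ^ t * a                                        ≡⟨ cong (q ^ t *_) (m∸n+n≡m de≤a) ⟨
        q ^ t * (a ∸ de + de)                            ≡⟨ *-distribˡ-+ (q ^ t) (a ∸ de) de ⟩
        q ^ t * (a ∸ de) + q ^ t * de                    ≤⟨ +-monoˡ-≤ (q ^ t * de) (*-monoˡ-≤ (a ∸ de) q^t≤) ⟩
        a ^ suc d * (a ∸ de) + q ^ t * de                ≤⟨ +-monoˡ-≤ (q ^ t * de) (+-cancelʳ-≤ (de * a ^ suc d) _ _ shifted) ⟩
        Y * a + q ^ t * de                               ≡⟨ cong (Y * a +_) (*-comm (q ^ t) de) ⟩
        Y * a + de * q ^ t                               ∎
        where
        de = suc d * e
        shifted : a ^ suc d * (a ∸ de) + de * a ^ suc d ≤ Y * a + de * a ^ suc d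
        shifted = begin
          a ^ suc d * (a ∸ de) + de * a ^ suc d          ≡⟨ cong (a ^ suc d * (a ∸ de) +_) (*-comm de (a ^ suc d)) ⟩
          a ^ suc d * (a ∸ de) + a ^ suc d * de          ≡⟨ *-distribˡ-+ (a ^ suc d) (a ∸ de) de ⟨
          a ^ suc d * (a ∸ de + de)                      ≡⟨ cong (a ^ suc d *_) (m∸n+n≡m de≤a) ⟩
          a ^ suc d * a                                  ≤⟨ bernoulli y e (suc d) ⟩
          Y * a + de * a ^ suc d                         ∎
      assoc₃ : ∀ E C X a → E * (C * X) * a ≡ E * C * (X * a)
      assoc₃ = solve-∀
      expand : ∀ E C Y a w X → E * C * (Y * a + w * X) ≡ E * (C * Y) * a + E * C * w * X
      expand = solve-∀
      factor : ∀ x a M X → x * a + M * (a * X) ≡ (x + M * X) * a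
      factor = solve-∀

  -- The second term of the bound contributes `C₀ / q` to the ratio, which is below `1 / E` once `q`
  -- exceeds `E C₀`.
  upper-asymptotics : ∀ (t C C₀ M : ℕ) (f : ℕ → ℕ) → 0 < M →
    (∀ q → f q * M ≤ C * q ^ suc t + M * (C₀ * q ^ t)) →
    ∀ E → ∃[ Q ] (∀ q → Q ≤ q → E * (f q * M) < E * (C * q ^ suc t) + M * q ^ suc t)
  upper-asymptotics t C C₀ M f 0<M bound E = suc (E * C₀) , λ q Q≤q → begin-strict
    E * (f q * M)                                             ≤⟨ *-monoʳ-≤ E (bound q) ⟩
    E * (C * q ^ suc t + M * (C₀ * q ^ t))                    ≡⟨ expand E (C * q ^ suc t) M C₀ (q ^ t) ⟩
    E * (C * q ^ suc t) + M * (E * C₀ * q ^ t)                <⟨ +-monoʳ-< (E * (C * q ^ suc t)) (*-monoʳ-< M {{>-nonZero 0<M}}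
                                                                   (*-monoˡ-< (q ^ t) {{>-nonZero (0<^ t (≤-trans (s≤s z≤n) Q≤q))}} Q≤q)) ⟩
    E * (C * q ^ suc t) + M * (q * q ^ t)                     ∎
    where
    open ≤-Reasoning
    expand : ∀ E x M c X → E * (x + M * (c * X)) ≡ E * x + M * (E * c * X)
    expand = solve-∀

-- Passage to rational numbers.

module Rationals where

  open import Defs using (ratio)
  open import Data.Integer.Base as ℤ using (+_; +<+)
  import Data.Integer.Properties as ℤ
  open import Data.Nat.Base as ℕ using (zero; suc)
  import Data.Nat.Properties as ℕ
  open import Data.Nat.Tactic.RingSolver using (solve-∀)
  open import Data.Product.Base using (∃-syntax; _,_)
  open import Data.Rational.Base using (mkℚ; 0ℚ; _<_; _-_; -_; _+_; ∣_∣; *<*; toℚᵘ)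
  import Data.Rational.Properties as ℚ
  open import Data.Rational.Unnormalised.Base as ℚᵘ using (mkℚᵘ; *<*)
  import Data.Rational.Unnormalised.Properties as ℚᵘ
  open import Data.Sum.Base using (inj₁; inj₂)
  open import Algebra.Properties.Group ℚ.+-0-group using (⁻¹-anti-homo-//)
  open import Relation.Binary.PropositionalEquality

  toℚᵘ-ratio : ∀ a d → toℚᵘ (ratio a (suc d)) ℚᵘ.≃ mkℚᵘ (+ a) d
  toℚᵘ-ratio a d = ℚ.toℚᵘ-fromℚᵘ (mkℚᵘ (+ a) d)

  x<y+z⇒x-y<z : ∀ x y z → x < y + z → x - y < z
  x<y+z⇒x-y<z x y z x<y+z = subst (x - y <_) (begin
    y + z - y      ≡⟨ cong (_- y) (ℚ.+-comm y z) ⟩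
    z + y - y      ≡⟨ ℚ.+-assoc z y (- y) ⟩
    z + (y - y)    ≡⟨ cong (λ w → z + w) (ℚ.+-inverseʳ y) ⟩
    z + 0ℚ         ≡⟨ ℚ.+-identityʳ z ⟩
    z              ∎) (ℚ.+-monoˡ-< (- y) x<y+z)
    where open ≡-Reasoning

  -- The last hypothesis is `a / b < c / d + 1 / E` multiplied out, and `1 / E` is at most `ε`
  -- because the numerator of `ε` is at least one.
  ratio-< : ∀ a b c d e E-1 ε → toℚᵘ ε ≡ mkℚᵘ (+ suc e) E-1 → let E = suc E-1 in
            0 ℕ.< b → 0 ℕ.< d → E ℕ.* (a ℕ.* d) ℕ.< E ℕ.* (c ℕ.* b) ℕ.+ d ℕ.* b →
            ratio a b - ratio c d < ε
  ratio-< a (suc b) c (suc d) e E-1 ε ε≡ _ _ lt = x<y+z⇒x-y<z (ratio a (suc b)) (ratio c (suc d)) ε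
    (ℚ.toℚᵘ-cancel-< (ℚᵘ.<-respˡ-≃ (ℚᵘ.≃-sym (toℚᵘ-ratio a b))
      (ℚᵘ.<-respʳ-≃ (ℚᵘ.≃-sym (ℚᵘ.≃-trans (ℚ.toℚᵘ-homo-+ (ratio c (suc d)) ε) (ℚᵘ.+-cong (toℚᵘ-ratio c d) (ℚᵘ.≃-reflexive ε≡))))
        (*<* (subst₂ ℤ._<_ (ℤ.pos-* a (suc d ℕ.* E)) rhs (+<+ nat))))))
    where
    E = suc E-1
    nat : a ℕ.* (suc d ℕ.* E) ℕ.< (c ℕ.* E ℕ.+ suc e ℕ.* suc d) ℕ.* suc b
    nat = begin-strict
      a ℕ.* (suc d ℕ.* E)                              ≡⟨ left a (suc d) E ⟩
      E ℕ.* (a ℕ.* suc d)                              <⟨ lt ⟩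
      E ℕ.* (c ℕ.* suc b) ℕ.+ suc d ℕ.* suc b          ≤⟨ ℕ.+-monoʳ-≤ (E ℕ.* (c ℕ.* suc b)) (ℕ.m≤n*m (suc d ℕ.* suc b) (suc e)) ⟩
      E ℕ.* (c ℕ.* suc b) ℕ.+ suc e ℕ.* (suc d ℕ.* suc b) ≡⟨ right E c (suc b) (suc e) (suc d) ⟩
      (c ℕ.* E ℕ.+ suc e ℕ.* suc d) ℕ.* suc b          ∎
      where
      open ℕ.≤-Reasoning
      left : ∀ a d E → a ℕ.* (d ℕ.* E) ≡ E ℕ.* (a ℕ.* d)
      left = solve-∀
      right : ∀ E c b e d → E ℕ.* (c ℕ.* b) ℕ.+ e ℕ.* (d ℕ.* b) ≡ (c ℕ.* E ℕ.+ e ℕ.* d) ℕ.* b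
      right = solve-∀
    rhs : + ((c ℕ.* E ℕ.+ suc e ℕ.* suc d) ℕ.* suc b) ≡ (+ c ℤ.* + E ℤ.+ + suc e ℤ.* + suc d) ℤ.* + suc b
    rhs = trans (ℤ.pos-* (c ℕ.* E ℕ.+ suc e ℕ.* suc d) (suc b)) (cong (ℤ._* + suc b)
      (trans (ℤ.pos-+ (c ℕ.* E) (suc e ℕ.* suc d)) (cong₂ ℤ._+_ (ℤ.pos-* c E) (ℤ.pos-* (suc e) (suc d)))))

  ratio-close : ∀ ε → 0ℚ < ε → ∃[ E ] (∀ a b c d → 0 ℕ.< b → 0 ℕ.< d →
    E ℕ.* (a ℕ.* d) ℕ.< E ℕ.* (c ℕ.* b) ℕ.+ d ℕ.* b →
    E ℕ.* (c ℕ.* b) ℕ.< E ℕ.* (a ℕ.* d) ℕ.+ d ℕ.* b →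
    ∣ ratio a b - ratio c d ∣ < ε)
  ratio-close (mkℚ (+ zero)  _   _) (*<* (+<+ ()))
  ratio-close ε@(mkℚ (+ suc e) E-1 _) _ = suc E-1 , close
    where
    close : ∀ a b c d → 0 ℕ.< b → 0 ℕ.< d → _ → _ → _
    close a b c d 0<b 0<d upper lower with ℚ.∣p∣≡p∨∣p∣≡-p (ratio a b - ratio c d)
    ... | inj₁ eq = subst (_< _) (sym eq) (ratio-< a b c d e E-1 ε refl 0<b 0<d upper)
    ... | inj₂ eq = subst (_< _) (sym (trans eq (⁻¹-anti-homo-// (ratio a b) (ratio c d))))
      (ratio-< c d a b e E-1 ε refl 0<d 0<b (subst (λ x → suc E-1 ℕ.* (c ℕ.* b) ℕ.< suc E-1 ℕ.* (a ℕ.* d) ℕ.+ x) (ℕ.*-comm d b) lower))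

-- Ceilings, congruences and the limit.

open Subsets
open Codes
open Asymptotics
open Rationals
open import Defs
open import Data.Fin.Subset using (Subset)
open import Data.List.Base using (List; length)
open import Data.List.Relation.Unary.Unique.Propositional using (Unique)
open import Data.Nat using (ℕ; zero; suc; _+_; _*_; _∸_; _^_; _/_; _≤_; z≤n; s≤s; s≤s⁻¹; NonZero; >-nonZero)
import Data.Nat as ℕ
open import Data.Nat.Combinatorics using (_C_)
open import Data.Nat.DivMod using (m*n/n≡m; /-monoˡ-≤; m<n*o⇒m/o<n)
open import Data.Nat.Properties
open import Data.Rational using (ℚ; 0ℚ; _<_; _-_; ∣_∣)
open import Data.Product using (Σ; ∃-syntax; _×_; _,_; proj₁; proj₂)
open import Data.Sum.Base using (inj₁; inj₂)
open import Relation.Binary.PropositionalEquality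
open import Relation.Nullary using (contradiction)

m≤n/d : ∀ m n d .{{_ : NonZero d}} → m * d ≤ n → m ≤ n / d
m≤n/d m n d md≤n = ≤-trans (≤-reflexive (sym (m*n/n≡m m d))) (/-monoˡ-≤ d md≤n)

-- As `l` lies between one and the divisor, adding the divisor minus one brings `a` to at least
-- `k + 1` and below `k + 2` multiples of it.
ceilDiv-≡ : ∀ a c k l → 1 ≤ l → l ≤ c → a ≡ k * c + l → ceilDiv a c ≡ suc k
ceilDiv-≡ a zero    k (suc l) _   ()  _
ceilDiv-≡ a (suc c) k l 1≤l l≤c a≡ = ≤-antisym
  (s≤s⁻¹ (m<n*o⇒m/o<n (begin-strict
    a + c                        ≡⟨ cong (_+ c) a≡ ⟩
    k * suc c + l + c            ≡⟨ +-assoc (k * suc c) l c ⟩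
    k * suc c + (l + c)          <⟨ +-monoʳ-< (k * suc c) (+-mono-≤-< l≤c (n<1+n c)) ⟩
    k * suc c + (suc c + suc c)  ≡⟨ +-comm (k * suc c) _ ⟩
    suc c + suc c + k * suc c    ≡⟨ +-assoc (suc c) (suc c) _ ⟩
    suc (suc k) * suc c          ∎)))
  (m≤n/d (suc k) (a + c) (suc c) (begin
    suc c + k * suc c            ≡⟨ +-comm (suc c) _ ⟩
    k * suc c + suc c            ≤⟨ +-monoʳ-≤ (k * suc c) (+-monoˡ-≤ c 1≤l) ⟩
    k * suc c + (l + c)          ≡⟨ +-assoc (k * suc c) l c ⟨
    k * suc c + l + c            ≡⟨ cong (_+ c) a≡ ⟨
    a + c                        ∎))
  where open ≤-Reasoning

-- With `a` positive and `l ≤ c`, the number `l` cannot exceed `a` by a positive multiple of `c`.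
CongMod⇒≡ : ∀ l a c → 1 ≤ a → l ≤ c → CongMod l a c → ∃[ k ] a ≡ k * c + l
CongMod⇒≡ l a c 1≤a l≤c (k     , inj₁ eq) = k , trans (sym eq) (+-comm l (k * c))
CongMod⇒≡ l a c 1≤a l≤c (zero  , inj₂ eq) = 0 , trans (sym (+-identityʳ a)) eq
CongMod⇒≡ l a c 1≤a l≤c (suc k , inj₂ eq) = contradiction l≤c (<⇒≱ (begin-strict
  c               <⟨ +-monoˡ-≤ c 1≤a ⟩
  a + c           ≤⟨ +-monoʳ-≤ a (m≤m+n c (k * c)) ⟩
  a + suc k * c   ≡⟨ eq ⟩
  l               ∎))
  where open ≤-Reasoning

limit : ∀ k K K₀ M D r (f : ℕ → ℕ) → 0 ℕ.< M → 0 ℕ.< D →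
  (∀ q → f q * M ≤ K * q ^ suc k + M * (K₀ * q ^ k)) →
  (∀ q h → suc (D * h) ^ suc r ≤ q → K * (D * h * suc (D * h) ^ (r + k * suc r)) ≤ f q * M) →
  ∀ ε → 0ℚ < ε → ∃[ Q ] (∀ q → Q ≤ q → ∣ ratio (f q) (q ^ suc k) - ratio K M ∣ < ε)
limit k K K₀ M D r f 0<M 0<D upper lower ε 0<ε =
  let E , close = ratio-close ε 0<ε
      Q₁ , above = upper-asymptotics k K K₀ M f 0<M upper E
      -- `suc k * suc r` reduces to `suc (r + k * suc r)`, so commutativity relates the exponents.
      Q₂ , below = lower-asymptotics D r (suc k) (r + k * suc r) K M f 0<D 0<M (*-comm (suc r) (suc k)) lower E
  -- The successor keeps `q` positive, so that `q ^ suc k` is a proper denominator.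
  in suc (Q₁ + Q₂) , λ q Q≤q → close (f q) (q ^ suc k) K M (0<^ (suc k) (≤-trans (s≤s z≤n) Q≤q)) 0<M
       (above q (≤-trans (m≤n⇒m≤1+n (m≤m+n Q₁ Q₂)) Q≤q))
       (below q (≤-trans (m≤n⇒m≤1+n (m≤n+m Q₂ Q₁)) Q≤q))

module _ (n c s l k : ℕ) (s≤c : s ≤ c) (l≤c : l ≤ c) (sn≡ : s * n ≡ c * k + l) (2≤c : 2 ≤ c)
  (m : ℕ) (f : ℕ → ℕ) (f-max : ∀ q → IsFrameproofMax q c s n (f q)) where

  maximum-upper-bound : ((F : List (Subset n)) → Unique F → IsGoodFamily n (suc k) l (s + 1) (c ∸ s + 1) F → length F ≤ m) →
    ∀ q → f q * ((n C suc k) ∸ m) ≤ (n C suc k) * q ^ suc k + ((n C suc k) ∸ m) * (length (subsetsOfSize n k) * q ^ k)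
  maximum-upper-bound F-max q = bound (proj₁ (f-max q))
    where
    l+b≡c : l + (c ∸ l) ≡ c
    l+b≡c = m+[n∸m]≡n l≤c
    k≤n : k ≤ n
    k≤n = *-cancelˡ-≤ c {{>-nonZero (≤-trans (s≤s z≤n) 2≤c)}} (begin
      c * k      ≤⟨ m≤m+n (c * k) l ⟩
      c * k + l  ≡⟨ sn≡ ⟨
      s * n      ≤⟨ *-monoˡ-≤ n s≤c ⟩
      c * n      ∎)
      where open ≤-Reasoning
    bound : (Σ (Code q n) λ Γ → Unique Γ × IsFrameproof c s Γ × length Γ ≡ f q) → _
    bound (Γ , Γ! , frameproof , |Γ|≡) =
      subst₂ (λ N K → N * (K ∸ m) ≤ K * q ^ suc k + (K ∸ m) * (length (subsetsOfSize n k) * q ^ k))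
        |Γ|≡ (length-subsetsOfSize n (suc k))
        (UpperBound.upper-bound l (c ∸ l) s (c ∸ s) k
          (trans (m+[n∸m]≡n s≤c) (sym l+b≡c)) (trans sn≡ (cong (λ x → x * k + l) (sym l+b≡c))) k≤n
          Γ Γ! (subst (λ x → IsFrameproof x s Γ) (sym l+b≡c) frameproof) m F-max)

  module _ (F : List (Subset n)) (F! : Unique F)
    (F-good : IsGoodFamily n (suc k) l (s + 1) (c ∸ s + 1) F) (|F|≡m : length F ≡ m) where

    module L = LowerBound c s (c ∸ s) l k (m+[n∸m]≡n s≤c) l≤c sn≡ F F! F-good

    -- `L.M` counts sets outside `F`, and `F` has `m` members. This carries positivity and the code
    -- sizes over to the denominator of the theorem.
    M≤ : L.M ≤ (n C suc k) ∸ m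
    M≤ = m+n≤o⇒m≤o∸n L.M (subst₂ (λ x y → L.M + x ≤ y) |F|≡m (length-subsetsOfSize n (suc k)) L.M+|F|≤)

    maximum-lower-bound : ∀ D r → L.CodesOver D r → ∀ q h → suc (D * h) ^ suc r ≤ q →
      (n C suc k) * (D * h * suc (D * h) ^ (r + k * suc r)) ≤ f q * ((n C suc k) ∸ m)
    maximum-lower-bound D r codes q h p≤q = bound (codes h q p≤q)
      where
      bound : (Σ (Code q n) λ Γ → Unique Γ × IsFrameproof c s Γ ×
                 length Γ * L.M ≡ length (subsetsOfSize n (suc k)) * (D * h * suc (D * h) ^ (r + k * suc r))) → _
      bound (Γ , Γ! , frameproof , size) =
        ≤-trans (≤-reflexive (trans (cong (_* (D * h * suc (D * h) ^ (r + k * suc r))) (sym (length-subsetsOfSize n (suc k)))) (sym size)))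
          (*-mono-≤ (proj₂ (f-max q) Γ Γ! frameproof) M≤)

theorem1p2 : (n c s t λ' : ℕ) → 2 ≤ n → 2 ≤ c → 1 ≤ s → s ≤ c ∸ 1 →
    t ≡ ceilDiv (s * n) c →
    1 ≤ λ' → λ' ≤ c → CongMod λ' (s * n) c →
    (m : ℕ) → IsMatchingNumber n t λ' (s + 1) (c ∸ s + 1) m →
    (f : ℕ → ℕ) → (∀ q → IsFrameproofMax q c s n (f q)) →
    (ε : ℚ) → 0ℚ < ε →
    ∃[ Q ] (∀ q → Q ≤ q →
    ∣ ratio (f q) (q ^ t) - ratio (n C t) ((n C t) ∸ m) ∣ < ε)
theorem1p2 n c s t l 2≤n 2≤c 1≤s s≤c-1 t≡ 1≤l l≤c cong-mod m matching f f-max ε 0<ε =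
  conclude (CongMod⇒≡ l (s * n) c (*-mono-≤ 1≤s (≤-trans (s≤s z≤n) 2≤n)) l≤c cong-mod)
  where
  s≤c : s ≤ c
  s≤c = ≤-trans s≤c-1 (m∸n≤m c 1)
  Goal : ℕ → Set
  Goal t = ∃[ Q ] (∀ q → Q ≤ q → ∣ ratio (f q) (q ^ t) - ratio (n C t) ((n C t) ∸ m) ∣ < ε)
  converges : ∀ k → s * n ≡ c * k + l → IsMatchingNumber n (suc k) l (s + 1) (c ∸ s + 1) m → Goal (suc k)
  converges k sn≡ ((F , F! , F-good , |F|≡m) , F-max) = with-codes codes-exist
    where
    open LowerBound c s (c ∸ s) l k (m+[n∸m]≡n s≤c) l≤c sn≡ F F! F-good
    with-codes : (∃[ D ] ∃[ r ] 0 ℕ.< D × CodesOver D r) → Goal (suc k)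
    with-codes (D , r , 0<D , codes) =
      limit k (n C suc k) (length (subsetsOfSize n k)) ((n C suc k) ∸ m) D r f
        (≤-trans M>0 (M≤ n c s l k s≤c l≤c sn≡ 2≤c m f f-max F F! F-good |F|≡m)) 0<D
        (maximum-upper-bound n c s l k s≤c l≤c sn≡ 2≤c m f f-max F-max)
        (maximum-lower-bound n c s l k s≤c l≤c sn≡ 2≤c m f f-max F F! F-good |F|≡m D r codes)
        ε 0<ε
  -- Once `s n` is written as `k c + l`, the ceiling `t` is `suc k`.
  conclude : (∃[ k ] s * n ≡ k * c + l) → Goal t
  conclude (k , sn≡) = subst Goal (sym t≡suck)
    (converges k (trans sn≡ (cong (_+ l) (*-comm k c))) (subst (λ t → IsMatchingNumber n t l (s + 1) (c ∸ s + 1) m) t≡suck matching))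
    where
    t≡suck : t ≡ suc k
    t≡suck = trans t≡ (ceilDiv-≡ (s * n) c k l 1≤l l≤c sn≡)
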